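{- Let $(\mathcal{M},\mathfrak{X})$ be a model of $\mathsf{GB}^{+\infty}$ or of $\mathsf{GB}^{ -\infty}$ (so $\mathcal{M}$ is a model of $\mathsf{ZF}^{+\infty}$, respectively $\mathsf{ZF}^{ -\infty}$). Then: (a) if $\mathcal{M}$ is $\omega$-standard and $(\mathcal{M},\mathfrak{X})\models\theta_{\mathsf{Most}}$, then $\mathfrak{X}=\mathfrak{X}_{\mathsf{Def}(\mathcal{M})}$; (b) $(\mathcal{M},\mathfrak{X}_{\mathsf{Def}(\mathcal{M})})\models\theta_{\mathsf{Most}}$.
   Context: $\mathsf{ZF}^{+\infty}=\mathsf{ZF}$, $\mathsf{GB}^{+\infty}=\mathsf{GB}$; $\mathsf{ZF}^{ -\infty}$ (resp. $\mathsf{GB}^{ -\infty}$) is $\mathsf{ZF}$ (resp. $\mathsf{GB}$) with infinity replaced by its negation, plus the axiom $\mathsf{TC}$ that every set has a transitive closure. Models of two-sorted theories are $(\mathcal{M},\mathfrak{X})$ with $\mathfrak{X}$ a collection of subsets of $M$. $\mathfrak{X}_{\mathsf{Def}(\mathcal{M})}$ is the collection of subsets of $M$ definable in $\mathcal{M}$ with parameters. $\mathcal{M}$ is $\omega$-standard if its finite ordinals are all standard. Inside the model: $c_a$ is a constant naming $a$; $\mathsf{depth}(\varphi)$ is the length of the longest path in the parsing tree; $\mathsf{Depth}_k$ = $\mathcal{L}_{\mathsf{ZF}}$-formulas of depth $\le k$; a class $T$ is a $\mathsf{Depth}_k$-truth class over $(V,\in)$ if $T$ consists of sentences obtained by substituting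 constants $c_a$ into formulas in $\mathsf{Depth}_k$ and for such sentences $\ulcorner c_a=c_b\urcorner\in T\leftrightarrow a=b$, $\ulcorner c_a\in c_b\urcorner\in T\leftrightarrow a\in b$, $\neg\psi\in T\leftrightarrow\psi\notin T$, $(\psi_1\vee\psi_2)\in T\leftrightarrow(\psi_1\in T\vee\psi_2\in T)$, $\exists v\,\psi(v)\in T\leftrightarrow\exists x\,\psi(c_x)\in T$. $\mathsf{T}_{\mathsf{Most}}(x)$: $x$ is a sentence $\varphi(c_{a_1},\dots,c_{a_n})$ with $\varphi$ an $\mathcal{L}_{\mathsf{ZF}}$-formula, and there exist $p\ge\mathsf{depth}(\varphi)$ and a class $T$ with $x\in T$ and $T$ a $\mathsf{Depth}_p$-truth class over $(V,\in)$. $\theta_{\mathsf{Most}}$ is the sentence: for every class $X$ there exist an $\mathcal{L}_{\mathsf{ZF}}$-formula $\varphi(x,y)$ and a set $a$ such that $X=\{b\in V:\varphi(c_b,c_a)\in\mathsf{T}_{\mathsf{Most}}\}$. -}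

module Defs where

open import Data.Fin using (Fin)
open import Data.Nat using (ℕ; zero; suc)
open import Data.Product using (Σ; ∃-syntax; _×_; _,_)
open import Data.Sum using (_⊎_)
open import Data.Vec using (Vec; []; _∷_; lookup)
open import Data.Vec.Relation.Unary.All using (All)
open import Function.Bundles using (_⇔_)
open import Level using (Level; _⊔_) renaming (suc to lsuc)
open import Relation.Binary.Core using (Rel)
open import Relation.Binary.Definitions using (_Respects_)
open import Relation.Binary.PropositionalEquality using (_≡_)
open import Relation.Nullary using (¬_)
open import Relation.Unary using (Pred; _≐_)

private variable
  ℓ ℓ′ : Level

record SetStructure (ℓ : Level) : Set (lsuc ℓ) where
  infix 4 _∈_
  field
    V   : Set ℓ
    _∈_ : Rel V ℓ

-- A collection of subsets of V.  Subsets are predicates identified when they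
-- have the same elements, so membership in the collection must respect _≐_
-- (this is the axiom of extensionality for classes).
record Classes (M : SetStructure ℓ) (ℓ′ : Level) : Set (lsuc (ℓ ⊔ ℓ′)) where
  open SetStructure M
  field
    IsClass  : Pred (Pred V ℓ) ℓ′
    respects : IsClass Respects _≐_

-- Two-sorted formulas without class quantifiers, with n free set variables
-- (de Bruijn indices) and k free class variables.  Those with k = 0 are the
-- formulas of the language {∈} of set theory.
data Formula (n k : ℕ) : Set where
  _≈ᶠ_ : Fin n → Fin n → Formula n k
  _∈ᶠ_ : Fin n → Fin n → Formula n k
  _∈ᶜ_ : Fin n → Fin k → Formula n k
  ¬ᶠ_  : Formula n k → Formula n k
  _∨ᶠ_ : Formula n k → Formula n k → Formula n k
  ∃ᶠ_  : Formula (suc n) k → Formula n k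

module _ (M : SetStructure ℓ) where
  open SetStructure M

  Sat : ∀ {n k} → Formula n k → Vec V n → Vec (Pred V ℓ) k → Set ℓ
  Sat (i ≈ᶠ j) a X = lookup a i ≡ lookup a j
  Sat (i ∈ᶠ j) a X = lookup a i ∈ lookup a j
  Sat (i ∈ᶜ j) a X = lookup X j (lookup a i)
  Sat (¬ᶠ φ)   a X = ¬ Sat φ a X
  Sat (φ ∨ᶠ ψ) a X = Sat φ a X ⊎ Sat ψ a X
  Sat (∃ᶠ φ)   a X = ∃[ x ] Sat φ (x ∷ a) X

  IsDefinable : Pred (Pred V ℓ) ℓ
  IsDefinable X =
    ∃[ n ] Σ (Formula (suc n) 0) λ φ → Σ (Vec V n) λ a →
      X ≐ (λ x → Sat φ (x ∷ a) [])

  𝔛-Def : Classes M ℓ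
  𝔛-Def = record
    { IsClass  = IsDefinable
    ; respects = λ where
        (X⊆Y , Y⊆X) (n , φ , a , X⊆φ , φ⊆X) →
          n , φ , a , (λ y → X⊆φ (Y⊆X y)) , (λ s → X⊆Y (φ⊆X s))
    }

  -- In the rest of this module, every set-level notion is a first-order
  -- formula over (V , ∈), written out through its satisfaction clauses: all
  -- quantifiers over sets range over V.

  _⊆ˢ_ : Rel V ℓ
  x ⊆ˢ y = ∀ z → z ∈ x → z ∈ y

  IsEmpty : Pred V ℓ
  IsEmpty x = ∀ z → ¬ z ∈ x

  IsUPair : V → V → V → Set ℓ
  IsUPair p x y = ∀ z → z ∈ p ⇔ (z ≡ x ⊎ z ≡ y)

  -- p = (x , y) (Kuratowski)
  IsPair : V → V → V → Set ℓ
  IsPair p x y = ∃[ u ] ∃[ v ] IsUPair u x x × IsUPair v x y × IsUPair p u v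

  ⟨_,_⟩∈_ : V → V → V → Set ℓ
  ⟨ x , y ⟩∈ r = ∃[ p ] IsPair p x y × p ∈ r

  IsSuc : V → V → Set ℓ
  IsSuc s x = ∀ z → z ∈ s ⇔ (z ∈ x ⊎ z ≡ x)

  Transitive : Pred V ℓ
  Transitive x = ∀ y → y ∈ x → y ⊆ˢ x

  _≤ᵒ_ : Rel V ℓ
  x ≤ᵒ y = x ∈ y ⊎ x ≡ y

  IsOrdinal : Pred V ℓ
  IsOrdinal x = Transitive x × (∀ y → y ∈ x → Transitive y)

  IsFiniteOrdinal : Pred V ℓ
  IsFiniteOrdinal x =
    IsOrdinal x × (∀ y → y ≤ᵒ x → IsEmpty y ⊎ (∃[ z ] IsSuc y z))

  IsNumeral : ℕ → V → Set ℓ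
  IsNumeral zero    x = IsEmpty x
  IsNumeral (suc n) x = ∃[ y ] IsNumeral n y × IsSuc x y

  OmegaStandard : Set ℓ
  OmegaStandard = ∀ x → IsFiniteOrdinal x → ∃[ n ] IsNumeral n x

  Infinity : Set ℓ
  Infinity = ∃[ w ]
    (∃[ e ] IsEmpty e × e ∈ w) ×
    (∀ x → x ∈ w → ∃[ s ] IsSuc s x × s ∈ w)

  TransitiveClosures : Set ℓ
  TransitiveClosures = ∀ a → ∃[ t ]
    Transitive t × a ⊆ˢ t × (∀ u → Transitive u → a ⊆ˢ u → t ⊆ˢ u)

  -- No global choice.  Comprehension is the full schema for formulas without
  -- class quantifiers, with set and class parameters.
  record GBCore (𝔛 : Classes M ℓ′) : Set (lsuc ℓ ⊔ ℓ′) where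
    open Classes 𝔛
    field
      extensionality : ∀ x y → (∀ z → z ∈ x ⇔ z ∈ y) → x ≡ y
      emptySet       : ∃[ x ] IsEmpty x
      pairing        : ∀ x y → ∃[ p ] IsUPair p x y
      union          : ∀ a → ∃[ u ] ∀ x → x ∈ u ⇔ (∃[ y ] x ∈ y × y ∈ a)
      powerSet       : ∀ a → ∃[ p ] ∀ x → x ∈ p ⇔ x ⊆ˢ a
      foundation     : ∀ a → (∃[ x ] x ∈ a) →
                       ∃[ x ] x ∈ a × (∀ y → y ∈ x → ¬ y ∈ a)
      comprehension  : ∀ {n k} (φ : Formula (suc n) k) (a : Vec V n)
                       (X : Vec (Pred V ℓ) k) → All IsClass X →
                       IsClass (λ x → Sat φ (x ∷ a) X)
      replacement    : ∀ (F : Pred V ℓ) → IsClass F →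
                       (∀ x y z p q → IsPair p x y → IsPair q x z →
                          F p → F q → y ≡ z) →
                       ∀ a → ∃[ b ] ∀ y →
                         y ∈ b ⇔ (∃[ x ] x ∈ a × (∃[ p ] IsPair p x y × F p))

  GB⁺ : Classes M ℓ′ → Set _
  GB⁺ 𝔛 = GBCore 𝔛 × Infinity

  GB⁻ : Classes M ℓ′ → Set _
  GB⁻ 𝔛 = GBCore 𝔛 × ¬ Infinity × TransitiveClosures

  -- Gödel coding inside M.  Terms:  vᵢ = (0 , i) for a finite ordinal i,
  -- and c_a = (1 , a).  Formulas:  t = u is (0 , (t , u)),  t ∈ u is
  -- (1 , (t , u)),  ¬ ψ is (2 , ψ),  ψ₁ ∨ ψ₂ is (3 , (ψ₁ , ψ₂)),  and
  -- ∃ vᵢ ψ is (4 , (i , ψ)).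

  IsTagged : ℕ → V → V → Set ℓ
  IsTagged n x y = ∃[ k ] IsNumeral n k × IsPair x k y

  IsVar : V → V → Set ℓ
  IsVar t i = IsFiniteOrdinal i × IsTagged 0 t i

  IsConst : V → V → Set ℓ
  IsConst t a = IsTagged 1 t a

  IsEq : V → V → V → Set ℓ
  IsEq x t u = ∃[ p ] IsPair p t u × IsTagged 0 x p

  IsMem : V → V → V → Set ℓ
  IsMem x t u = ∃[ p ] IsPair p t u × IsTagged 1 x p

  IsNeg : V → V → Set ℓ
  IsNeg x ψ = IsTagged 2 x ψ

  IsOr : V → V → V → Set ℓ
  IsOr x ψ₁ ψ₂ = ∃[ p ] IsPair p ψ₁ ψ₂ × IsTagged 3 x p

  IsEx : V → V → V → Set ℓ
  IsEx x i ψ = IsFiniteOrdinal i × (∃[ p ] IsPair p i ψ × IsTagged 4 x p)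

  -- The next three notions are recursions on formulas carried out inside M.
  -- Each is expressed by a set r of pairs (or triples) all of whose members
  -- are justified, in one step, by other members; by foundation in M such a
  -- set contains only correct values of the recursion.

  IsMax : V → V → V → Set ℓ
  IsMax m d e = (m ≡ d ⊎ m ≡ e) × d ≤ᵒ m × e ≤ᵒ m

  DepthStep : V → V → V → Set ℓ
  DepthStep r φ d =
      ((∃[ t ] ∃[ u ] ∃[ i ] ∃[ j ]
          IsVar t i × IsVar u j × (IsEq φ t u ⊎ IsMem φ t u)) × IsEmpty d)
    ⊎ (∃[ ψ ] ∃[ e ] IsNeg φ ψ × ⟨ ψ , e ⟩∈ r × IsSuc d e)
    ⊎ (∃[ ψ₁ ] ∃[ ψ₂ ] ∃[ e₁ ] ∃[ e₂ ] ∃[ m ]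
          IsOr φ ψ₁ ψ₂ × ⟨ ψ₁ , e₁ ⟩∈ r × ⟨ ψ₂ , e₂ ⟩∈ r ×
          IsMax m e₁ e₂ × IsSuc d m)
    ⊎ (∃[ i ] ∃[ ψ ] ∃[ e ] IsEx φ i ψ × ⟨ ψ , e ⟩∈ r × IsSuc d e)

  -- φ is (the code of) an {∈}-formula, without constants, of depth d.  Atomic
  -- formulas have depth 0: the length of a path is its number of edges.
  HasDepth : V → V → Set ℓ
  HasDepth φ d = IsFiniteOrdinal d ×
    (∃[ r ] ⟨ φ , d ⟩∈ r × (∀ ψ e → ⟨ ψ , e ⟩∈ r → DepthStep r ψ e))

  FreeVarsStep : V → V → V → Set ℓ
  FreeVarsStep r φ f =
      (∃[ t ] ∃[ u ] (IsEq φ t u ⊎ IsMem φ t u) ×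
          (∀ k → k ∈ f ⇔ (IsVar t k ⊎ IsVar u k)))
    ⊎ (∃[ ψ ] IsNeg φ ψ × ⟨ ψ , f ⟩∈ r)
    ⊎ (∃[ ψ₁ ] ∃[ ψ₂ ] ∃[ f₁ ] ∃[ f₂ ]
          IsOr φ ψ₁ ψ₂ × ⟨ ψ₁ , f₁ ⟩∈ r × ⟨ ψ₂ , f₂ ⟩∈ r ×
          (∀ k → k ∈ f ⇔ (k ∈ f₁ ⊎ k ∈ f₂)))
    ⊎ (∃[ i ] ∃[ ψ ] ∃[ g ] IsEx φ i ψ × ⟨ ψ , g ⟩∈ r ×
          (∀ k → k ∈ f ⇔ (k ∈ g × ¬ k ≡ i)))

  -- f is the set of all i such that vᵢ is free in φ.
  HasFreeVars : V → V → Set ℓ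
  HasFreeVars φ f =
    ∃[ r ] ⟨ φ , f ⟩∈ r × (∀ ψ g → ⟨ ψ , g ⟩∈ r → FreeVarsStep r ψ g)

  -- A set function s from finite ordinals to V stands for the substitution of
  -- the constant c_{s(i)} for each free variable vᵢ with i in the domain of s.
  IsAssignment : Pred V ℓ
  IsAssignment s =
    (∀ p → p ∈ s → ∃[ i ] ∃[ a ] IsFiniteOrdinal i × IsPair p i a) ×
    (∀ i a b → ⟨ i , a ⟩∈ s → ⟨ i , b ⟩∈ s → a ≡ b)

  IsTermSubst : V → V → V → Set ℓ
  IsTermSubst s t t′ =
      (∃[ i ] ∃[ a ] IsVar t i × ⟨ i , a ⟩∈ s × IsConst t′ a)
    ⊎ (∃[ i ] IsVar t i × (∀ a → ¬ (⟨ i , a ⟩∈ s)) × t′ ≡ t)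
    ⊎ (∃[ a ] IsConst t a × t′ ≡ t)

  -- s′ is s with i removed from its domain.
  IsWithout : V → V → V → Set ℓ
  IsWithout s′ s i = ∀ p → p ∈ s′ ⇔ (p ∈ s × ¬ (∃[ a ] IsPair p i a))

  ⟨_∣_∣_⟩∈_ : V → V → V → V → Set ℓ
  ⟨ s ∣ x ∣ y ⟩∈ r = ∃[ p ] IsPair p x y × ⟨ s , p ⟩∈ r

  SubstStep : V → V → V → V → Set ℓ
  SubstStep r s φ χ =
      (∃[ t ] ∃[ u ] ∃[ t′ ] ∃[ u′ ]
          IsTermSubst s t t′ × IsTermSubst s u u′ ×
          ((IsEq φ t u × IsEq χ t′ u′) ⊎ (IsMem φ t u × IsMem χ t′ u′)))
    ⊎ (∃[ ψ ] ∃[ ψ′ ] IsNeg φ ψ × IsNeg χ ψ′ × ⟨ s ∣ ψ ∣ ψ′ ⟩∈ r)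
    ⊎ (∃[ ψ₁ ] ∃[ ψ₂ ] ∃[ ψ₁′ ] ∃[ ψ₂′ ]
          IsOr φ ψ₁ ψ₂ × IsOr χ ψ₁′ ψ₂′ ×
          ⟨ s ∣ ψ₁ ∣ ψ₁′ ⟩∈ r × ⟨ s ∣ ψ₂ ∣ ψ₂′ ⟩∈ r)
    ⊎ (∃[ i ] ∃[ ψ ] ∃[ ψ′ ] ∃[ s′ ]
          IsEx φ i ψ × IsEx χ i ψ′ × IsWithout s′ s i × ⟨ s′ ∣ ψ ∣ ψ′ ⟩∈ r)

  -- χ is the result of applying the substitution s to φ, where φ may already
  -- contain constants.
  IsSubst : V → V → V → Set ℓ
  IsSubst s φ χ =
    ∃[ r ] ⟨ s ∣ φ ∣ χ ⟩∈ r ×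
           (∀ s′ ψ ψ′ → ⟨ s′ ∣ ψ ∣ ψ′ ⟩∈ r → SubstStep r s′ ψ ψ′)

  -- χ is ψ(c_a), the result of substituting c_a for vᵢ in ψ.
  IsInstance : V → V → V → V → Set ℓ
  IsInstance i a ψ χ =
    ∃[ s ] ∃[ p ] IsPair p i a × IsUPair s p p × IsSubst s ψ χ

  -- χ is φ(c_b , c_a), the result of substituting c_b for v₀ and c_a for v₁.
  IsInstance₂ : V → V → V → V → Set ℓ
  IsInstance₂ b a φ χ =
    ∃[ s ] ∃[ i ] ∃[ j ] ∃[ p ] ∃[ q ]
      IsNumeral 0 i × IsNumeral 1 j × IsPair p i b × IsPair q j a ×
      IsUPair s p q × IsSubst s φ χ

  -- χ is a sentence φ(c_{a₁} , … , c_{aₙ}), where φ is an {∈}-formula of depth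
  -- d.  Values of s outside the free variables of φ are irrelevant.
  IsSentenceOfDepth : V → V → Set ℓ
  IsSentenceOfDepth χ d = ∃[ φ ] ∃[ f ] ∃[ s ]
    HasDepth φ d × HasFreeVars φ f × IsAssignment s ×
    (∀ i → i ∈ f → ∃[ a ] ⟨ i , a ⟩∈ s) × IsSubst s φ χ

  IsDepthSentence : V → V → Set ℓ
  IsDepthSentence k χ = ∃[ d ] d ≤ᵒ k × IsSentenceOfDepth χ d

  record IsDepthTruthClass (k : V) (T : Pred V ℓ) : Set ℓ where
    field
      sentences : ∀ χ → T χ → IsDepthSentence k χ
      eq  : ∀ χ t u a b → IsConst t a → IsConst u b → IsEq χ t u →
            IsDepthSentence k χ → T χ ⇔ a ≡ b
      mem : ∀ χ t u a b → IsConst t a → IsConst u b → IsMem χ t u →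
            IsDepthSentence k χ → T χ ⇔ a ∈ b
      neg : ∀ χ ψ → IsNeg χ ψ → IsDepthSentence k χ → T χ ⇔ (¬ T ψ)
      or  : ∀ χ ψ₁ ψ₂ → IsOr χ ψ₁ ψ₂ → IsDepthSentence k χ →
            T χ ⇔ (T ψ₁ ⊎ T ψ₂)
      ex  : ∀ χ i ψ → IsEx χ i ψ → IsDepthSentence k χ →
            T χ ⇔ (∃[ x ] ∃[ ψ′ ] IsInstance i x ψ ψ′ × T ψ′)

  module _ (𝔛 : Classes M ℓ′) where
    open Classes 𝔛

    T-Most : V → Set (lsuc ℓ ⊔ ℓ′)
    T-Most χ = ∃[ d ] IsSentenceOfDepth χ d ×
      (∃[ p ] IsFiniteOrdinal p × d ≤ᵒ p ×
        (∃[ T ] IsClass T × T χ × IsDepthTruthClass p T))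

    -- (M , 𝔛) ⊨ θ-Most.  The free variables x , y of φ(x , y) are v₀ , v₁.
    θ-Most : Set (lsuc ℓ ⊔ ℓ′)
    θ-Most = ∀ X → IsClass X →
      ∃[ φ ] ∃[ d ] ∃[ f ] ∃[ a ]
        HasDepth φ d × HasFreeVars φ f ×
        (∀ i → i ∈ f → IsNumeral 0 i ⊎ IsNumeral 1 i) ×
        (∀ b → X b ⇔ (∃[ χ ] IsInstance₂ b a φ χ × T-Most χ))

{-# OPTIONS --safe #-}
-- For each standard n, Tarski's clauses can be unwound n times into a formula
-- True n over (V , ∈) defining truth for coded sentences of depth at most n.
-- Cut down to the sentences of depth at most n it is a definable truth class,
-- and by induction on n every truth class of M, of any finite depth p, agrees
-- with True n on the sentences of depth at most n to which both apply.  Hence on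
-- instances of a formula of standard depth T-Most is True n.  For (a),
-- ω-standardness makes the depth of the formula given by θ-Most standard, so the
-- class is {b : True n (φ(c_b , c_a))}, which is definable from φ and a.  For (b),
-- a definition of X is coded inside M after pairing its parameters into one
-- set a, and True n is correct on the instances of this code.  Since all depths
-- involved are standard, no induction inside M is needed.

module Submission where

open import Defs
open import Axiom.ExcludedMiddle using (ExcludedMiddle)
open import Data.Empty using (⊥; ⊥-elim)
open import Data.Fin using (Fin; zero; suc; _↑ʳ_)
open import Data.Nat as ℕ using (ℕ; zero; suc; _≤_; _<_; s≤s)
open import Data.Nat.Properties using
  (n<1+n; <-trans; <-cmp; <⇒≢; m<n⇒m<1+n; m<1+n⇒m<n∨m≡n; m≤n⇒m<n∨m≡n; ⊔-sel; m≤m⊔n; m≤n⊔m)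
open import Data.Product using (Σ; ∃; ∃₂; ∃-syntax; _×_; _,_; proj₁; proj₂; uncurry)
open import Data.Product.Function.NonDependent.Propositional using (_×-⇔_)
open import Data.Sum using (_⊎_; inj₁; inj₂; [_,_]′; map₂) renaming (map to ⊎-map)
open import Data.Sum.Function.Propositional using (_⊎-⇔_)
open import Data.Vec using (Vec; []; _∷_; lookup; tabulate)
open import Data.Vec.Properties using (lookup∘tabulate; tabulate∘lookup)
open import Data.Vec.Relation.Unary.All using ([])
open import Function using (_∘_; id; case_of_)
open import Function.Bundles using (_⇔_; mk⇔; Equivalence)
open import Function.Related.TypeIsomorphisms using (¬-cong-⇔)
open import Level using (Level; _⊔_; Lift; lift; lower) renaming (suc to lsuc)
open import Relation.Binary.Definitions using (tri<; tri≈; tri>)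
open import Relation.Binary.PropositionalEquality using (_≡_; _≢_; refl; sym; trans; cong; cong₂; subst)
open import Relation.Nullary using (¬_; yes; no; contradiction)
open import Relation.Nullary.Decidable using (decidable-stable; map′)
open import Relation.Unary using (Pred; _≐_)
import Function.Properties.Equivalence as ⇔

open Equivalence using (to; from)

-- Two features of the definitions shape the proof. `IsSentenceOfDepth` presents a sentence as one
-- substitution applied to a formula without constants, whereas Tarski's clause for a quantifier
-- puts one more constant into the body. Induction passes through a quantifier only because the two
-- substitutions compose: removing `i` from `s` and then putting c_x for v_i amounts to updating `s`
-- at `i`. Moreover an instance is not a part of the formula, and the depth `p` of a truth class may
-- be nonstandard, so neither the code nor `p` can carry the induction; the external bound `n` does.
-- Depth, free variables and substitution are certified inside M by closed sets of values. Such sets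
-- can be unfolded and extended one step at a time, which is all that an external induction asks of
-- them. Finally, `T-Most` is evaluated over `𝔛` in (a) but over `𝔛-Def M` in (b), so its comparison
-- with `True n` is made for any collection of classes that contains `TruthClass n`.

infixr 0 _⨾_

_⨾_ : ∀ {a b c} {A : Set a} {B : Set b} {C : Set c} → A ⇔ B → B ⇔ C → A ⇔ C
_⨾_ = ⇔.trans

∃-cong-⇔ : ∀ {a b c} {A : Set a} {P : A → Set b} {Q : A → Set c} →
           (∀ x → P x ⇔ Q x) → ∃ P ⇔ ∃ Q
∃-cong-⇔ e = mk⇔ (λ (x , p) → x , to (e x) p) (λ (x , q) → x , from (e x) q)

-- First-order definability over (V , ∈).

rename : ∀ {m n k} → (Fin m → Fin n) → Formula m k → Formula n k
rename ρ (i ≈ᶠ j) = ρ i ≈ᶠ ρ j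
rename ρ (i ∈ᶠ j) = ρ i ∈ᶠ ρ j
rename ρ (i ∈ᶜ j) = ρ i ∈ᶜ j
rename ρ (¬ᶠ φ)   = ¬ᶠ rename ρ φ
rename ρ (φ ∨ᶠ ψ) = rename ρ φ ∨ᶠ rename ρ ψ
rename ρ (∃ᶠ φ)   = ∃ᶠ rename (λ where zero → zero ; (suc i) → suc (ρ i)) φ

module Definability {ℓ : Level} (em : ExcludedMiddle ℓ) (M : SetStructure ℓ) where
  open SetStructure M

  Sat-rename : ∀ {m n k} (φ : Formula m k) {ρ : Fin m → Fin n} {a b} {X : Vec (Pred V ℓ) k} →
               (∀ i → lookup b (ρ i) ≡ lookup a i) →
               Sat M (rename ρ φ) b X ⇔ Sat M φ a X
  Sat-rename (i ≈ᶠ j) e rewrite e i | e j = ⇔.refl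
  Sat-rename (i ∈ᶠ j) e rewrite e i | e j = ⇔.refl
  Sat-rename (i ∈ᶜ j) e rewrite e i = ⇔.refl
  Sat-rename (¬ᶠ φ)   e = ¬-cong-⇔ (Sat-rename φ e)
  Sat-rename (φ ∨ᶠ ψ) e = Sat-rename φ e ⊎-⇔ Sat-rename ψ e
  Sat-rename (∃ᶠ φ)   e =
    ∃-cong-⇔ λ x → Sat-rename φ λ where zero → refl ; (suc i) → e i

  -- Comprehension speaks of deeply embedded formulas, while the coding notions are Agda types. The
  -- combinators below follow the shape of those types, so that finding the formula for a notion
  -- amounts to transcribing its definition.
  record Definable {n : ℕ} (P : Vec V n → Set ℓ) : Set ℓ where
    constructor _by_
    field
      formula : Formula n 0
      defines : ∀ a → Sat M formula a [] ⇔ P a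

  open Definable public

  definable⇒IsDefinable : ∀ {n} {P : Vec V (suc n) → Set ℓ} → Definable P →
                          ∀ v → IsDefinable M (λ x → P (x ∷ v))
  definable⇒IsDefinable (φ by c) v =
    _ , φ , v , (λ {x} → from (c (x ∷ v))) , (λ {x} → to (c (x ∷ v)))

  satᵈ : ∀ {n} (φ : Formula n 0) → Definable (λ a → Sat M φ a [])
  satᵈ φ = φ by λ _ → ⇔.refl

  private variable
    n : ℕ
    P Q : Vec V n → Set ℓ

  infixr 3 ¬ᵈ_
  infixr 2 _×ᵈ_
  infixr 1 _⊎ᵈ_
  infix  4 _≡ᵈ_ _∈ᵈ_ _≤ᵒᵈ_
  infixr 0 _⇔ᵈ_ _→ᵈ_

  respᵈ : (∀ a → P a ⇔ Q a) → Definable P → Definable Q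
  respᵈ e (φ by c) = φ by λ a → c a ⨾ e a

  renameᵈ : ∀ {m} {R : Vec V m → Set ℓ} (ρ : Fin m → Fin n) → Definable R →
            Definable {n} (λ a → R (tabulate (lookup a ∘ ρ)))
  renameᵈ ρ (φ by c) = rename ρ φ by λ a →
    Sat-rename φ (λ i → sym (lookup∘tabulate (lookup a ∘ ρ) i)) ⨾ c _

  _≡ᵈ_ : (i j : Fin n) → Definable (λ a → lookup a i ≡ lookup a j)
  i ≡ᵈ j = (i ≈ᶠ j) by λ _ → ⇔.refl

  _∈ᵈ_ : (i j : Fin n) → Definable (λ a → lookup a i ∈ lookup a j)
  i ∈ᵈ j = (i ∈ᶠ j) by λ _ → ⇔.refl

  ¬ᵈ_ : Definable P → Definable (λ a → ¬ P a)
  ¬ᵈ (φ by c) = (¬ᶠ φ) by λ a → ¬-cong-⇔ (c a)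

  _⊎ᵈ_ : Definable P → Definable Q → Definable (λ a → P a ⊎ Q a)
  (φ by c) ⊎ᵈ (ψ by d) = (φ ∨ᶠ ψ) by λ a → c a ⊎-⇔ d a

  ∃ᵈ : {P : Vec V (suc n) → Set ℓ} → Definable P → Definable (λ a → ∃[ x ] P (x ∷ a))
  ∃ᵈ (φ by c) = (∃ᶠ φ) by λ a → ∃-cong-⇔ λ x → c (x ∷ a)

  -- Formulas have only negation, disjunction and existential quantification. Conjunction, universal
  -- quantification and implication are the classical abbreviations, and excluded middle identifies
  -- them with the Agda connectives.
  _×ᵈ_ : Definable P → Definable Q → Definable (λ a → P a × Q a)
  p ×ᵈ q = respᵈ
    (λ a → mk⇔ (λ h → decidable-stable em (λ ¬p → h (inj₁ ¬p)) ,
                      decidable-stable em (λ ¬q → h (inj₂ ¬q)))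
               (λ (p , q) → [ (λ ¬p → ¬p p) , (λ ¬q → ¬q q) ]′))
    (¬ᵈ (¬ᵈ p ⊎ᵈ ¬ᵈ q))

  ∀ᵈ : {P : Vec V (suc n) → Set ℓ} → Definable P → Definable (λ a → ∀ x → P (x ∷ a))
  ∀ᵈ p = respᵈ
    (λ a → mk⇔ (λ h x → decidable-stable em (λ ¬p → h (x , ¬p)))
               (λ h (x , ¬p) → ¬p (h x)))
    (¬ᵈ ∃ᵈ (¬ᵈ p))

  _→ᵈ_ : Definable P → Definable Q → Definable (λ a → P a → Q a)
  _→ᵈ_ {P = P} p q = respᵈ
    (λ a → mk⇔ (λ h x → [ (λ ¬p → contradiction x ¬p) , id ]′ h) (dec a))
    (¬ᵈ p ⊎ᵈ q)
    where
    dec : ∀ a → (P a → _) → ¬ P a ⊎ _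
    dec a f with em {P = P a}
    ... | yes x = inj₂ (f x)
    ... | no ¬x = inj₁ ¬x

  _⇔ᵈ_ : Definable P → Definable Q → Definable (λ a → P a ⇔ Q a)
  p ⇔ᵈ q = respᵈ (λ a → mk⇔ (uncurry mk⇔) (λ e → to e , from e))
    ((p →ᵈ q) ×ᵈ (q →ᵈ p))

  -- Under k new binders the bound variables are `v₀`, `v₁`, ... from the innermost outwards, and an
  -- outer index `i` becomes `k ↑ʳ i`.
  pattern v₀ = zero
  pattern v₁ = suc v₀
  pattern v₂ = suc v₁
  pattern v₃ = suc v₂
  pattern v₄ = suc v₃

  -- The coding notions as formulas.

  IsEmptyᵈ : (i : Fin n) → Definable (λ a → IsEmpty M (lookup a i))
  IsEmptyᵈ i = ∀ᵈ (¬ᵈ v₀ ∈ᵈ 1 ↑ʳ i)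

  IsUPairᵈ : (i j k : Fin n) →
             Definable (λ a → IsUPair M (lookup a i) (lookup a j) (lookup a k))
  IsUPairᵈ i j k = ∀ᵈ (v₀ ∈ᵈ 1 ↑ʳ i ⇔ᵈ v₀ ≡ᵈ 1 ↑ʳ j ⊎ᵈ v₀ ≡ᵈ 1 ↑ʳ k)

  IsPairᵈ : (i j k : Fin n) →
            Definable (λ a → IsPair M (lookup a i) (lookup a j) (lookup a k))
  IsPairᵈ i j k = ∃ᵈ (∃ᵈ (IsUPairᵈ v₁ (2 ↑ʳ j) (2 ↑ʳ j) ×ᵈ IsUPairᵈ v₀ (2 ↑ʳ j) (2 ↑ʳ k) ×ᵈ
                          IsUPairᵈ (2 ↑ʳ i) v₁ v₀))

  ⟨_,_⟩∈ᵈ_ : (i j k : Fin n) →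
             Definable (λ a → ⟨_,_⟩∈_ M (lookup a i) (lookup a j) (lookup a k))
  ⟨ i , j ⟩∈ᵈ k = ∃ᵈ (IsPairᵈ v₀ (1 ↑ʳ i) (1 ↑ʳ j) ×ᵈ v₀ ∈ᵈ 1 ↑ʳ k)

  IsSucᵈ : (i j : Fin n) → Definable (λ a → IsSuc M (lookup a i) (lookup a j))
  IsSucᵈ i j = ∀ᵈ (v₀ ∈ᵈ 1 ↑ʳ i ⇔ᵈ v₀ ∈ᵈ 1 ↑ʳ j ⊎ᵈ v₀ ≡ᵈ 1 ↑ʳ j)

  Transitiveᵈ : (i : Fin n) → Definable (λ a → Transitive M (lookup a i))
  Transitiveᵈ i = ∀ᵈ (v₀ ∈ᵈ 1 ↑ʳ i →ᵈ ∀ᵈ (v₀ ∈ᵈ v₁ →ᵈ v₀ ∈ᵈ 2 ↑ʳ i))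

  _≤ᵒᵈ_ : (i j : Fin n) → Definable (λ a → _≤ᵒ_ M (lookup a i) (lookup a j))
  i ≤ᵒᵈ j = i ∈ᵈ j ⊎ᵈ i ≡ᵈ j

  IsFiniteOrdinalᵈ : (i : Fin n) → Definable (λ a → IsFiniteOrdinal M (lookup a i))
  IsFiniteOrdinalᵈ i =
    (Transitiveᵈ i ×ᵈ ∀ᵈ (v₀ ∈ᵈ 1 ↑ʳ i →ᵈ Transitiveᵈ v₀)) ×ᵈ
    ∀ᵈ (v₀ ≤ᵒᵈ (1 ↑ʳ i) →ᵈ IsEmptyᵈ v₀ ⊎ᵈ ∃ᵈ (IsSucᵈ v₁ v₀))

  IsNumeralᵈ : ∀ m (i : Fin n) → Definable (λ a → IsNumeral M m (lookup a i))
  IsNumeralᵈ zero    i = IsEmptyᵈ i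
  IsNumeralᵈ (suc m) i = ∃ᵈ (IsNumeralᵈ m v₀ ×ᵈ IsSucᵈ (1 ↑ʳ i) v₀)

  IsTaggedᵈ : ∀ m (i j : Fin n) → Definable (λ a → IsTagged M m (lookup a i) (lookup a j))
  IsTaggedᵈ m i j = ∃ᵈ (IsNumeralᵈ m v₀ ×ᵈ IsPairᵈ (1 ↑ʳ i) v₀ (1 ↑ʳ j))

  IsVarᵈ : (i j : Fin n) → Definable (λ a → IsVar M (lookup a i) (lookup a j))
  IsVarᵈ i j = IsFiniteOrdinalᵈ j ×ᵈ IsTaggedᵈ 0 i j

  IsConstᵈ : (i j : Fin n) → Definable (λ a → IsConst M (lookup a i) (lookup a j))
  IsConstᵈ = IsTaggedᵈ 1

  IsTaggedPairᵈ : ∀ m (i j k : Fin n) → Definable (λ a →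
    ∃[ p ] IsPair M p (lookup a j) (lookup a k) × IsTagged M m (lookup a i) p)
  IsTaggedPairᵈ m i j k = ∃ᵈ (IsPairᵈ v₀ (1 ↑ʳ j) (1 ↑ʳ k) ×ᵈ IsTaggedᵈ m (1 ↑ʳ i) v₀)

  IsEqᵈ : (i j k : Fin n) → Definable (λ a → IsEq M (lookup a i) (lookup a j) (lookup a k))
  IsEqᵈ = IsTaggedPairᵈ 0

  IsMemᵈ : (i j k : Fin n) → Definable (λ a → IsMem M (lookup a i) (lookup a j) (lookup a k))
  IsMemᵈ = IsTaggedPairᵈ 1

  IsNegᵈ : (i j : Fin n) → Definable (λ a → IsNeg M (lookup a i) (lookup a j))
  IsNegᵈ = IsTaggedᵈ 2

  IsOrᵈ : (i j k : Fin n) → Definable (λ a → IsOr M (lookup a i) (lookup a j) (lookup a k))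
  IsOrᵈ = IsTaggedPairᵈ 3

  IsExᵈ : (i j k : Fin n) → Definable (λ a → IsEx M (lookup a i) (lookup a j) (lookup a k))
  IsExᵈ i j k = IsFiniteOrdinalᵈ j ×ᵈ IsTaggedPairᵈ 4 i j k

  IsMaxᵈ : (i j k : Fin n) → Definable (λ a → IsMax M (lookup a i) (lookup a j) (lookup a k))
  IsMaxᵈ i j k = (i ≡ᵈ j ⊎ᵈ i ≡ᵈ k) ×ᵈ j ≤ᵒᵈ i ×ᵈ k ≤ᵒᵈ i

  DepthStepᵈ : (r φ d : Fin n) →
               Definable (λ a → DepthStep M (lookup a r) (lookup a φ) (lookup a d))
  DepthStepᵈ r φ d =
       (∃ᵈ (∃ᵈ (∃ᵈ (∃ᵈ (IsVarᵈ v₃ v₁ ×ᵈ IsVarᵈ v₂ v₀ ×ᵈ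
          (IsEqᵈ (4 ↑ʳ φ) v₃ v₂ ⊎ᵈ IsMemᵈ (4 ↑ʳ φ) v₃ v₂))))) ×ᵈ IsEmptyᵈ d)
    ⊎ᵈ ∃ᵈ (∃ᵈ (IsNegᵈ (2 ↑ʳ φ) v₁ ×ᵈ ⟨ v₁ , v₀ ⟩∈ᵈ (2 ↑ʳ r) ×ᵈ IsSucᵈ (2 ↑ʳ d) v₀))
    ⊎ᵈ ∃ᵈ (∃ᵈ (∃ᵈ (∃ᵈ (∃ᵈ (IsOrᵈ (5 ↑ʳ φ) v₄ v₃ ×ᵈ
          ⟨ v₄ , v₂ ⟩∈ᵈ (5 ↑ʳ r) ×ᵈ ⟨ v₃ , v₁ ⟩∈ᵈ (5 ↑ʳ r) ×ᵈ
          IsMaxᵈ v₀ v₂ v₁ ×ᵈ IsSucᵈ (5 ↑ʳ d) v₀)))))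
    ⊎ᵈ ∃ᵈ (∃ᵈ (∃ᵈ (IsExᵈ (3 ↑ʳ φ) v₂ v₁ ×ᵈ
          ⟨ v₁ , v₀ ⟩∈ᵈ (3 ↑ʳ r) ×ᵈ IsSucᵈ (3 ↑ʳ d) v₀)))

  HasDepthᵈ : (φ d : Fin n) → Definable (λ a → HasDepth M (lookup a φ) (lookup a d))
  HasDepthᵈ φ d = IsFiniteOrdinalᵈ d ×ᵈ
    ∃ᵈ (⟨ 1 ↑ʳ φ , 1 ↑ʳ d ⟩∈ᵈ v₀ ×ᵈ
        ∀ᵈ (∀ᵈ (⟨ v₁ , v₀ ⟩∈ᵈ v₂ →ᵈ DepthStepᵈ v₂ v₁ v₀)))

  FreeVarsStepᵈ : (r φ f : Fin n) →
                  Definable (λ a → FreeVarsStep M (lookup a r) (lookup a φ) (lookup a f))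
  FreeVarsStepᵈ r φ f =
       ∃ᵈ (∃ᵈ ((IsEqᵈ (2 ↑ʳ φ) v₁ v₀ ⊎ᵈ IsMemᵈ (2 ↑ʳ φ) v₁ v₀) ×ᵈ
          ∀ᵈ (v₀ ∈ᵈ 3 ↑ʳ f ⇔ᵈ IsVarᵈ v₂ v₀ ⊎ᵈ IsVarᵈ v₁ v₀)))
    ⊎ᵈ ∃ᵈ (IsNegᵈ (1 ↑ʳ φ) v₀ ×ᵈ ⟨ v₀ , 1 ↑ʳ f ⟩∈ᵈ (1 ↑ʳ r))
    ⊎ᵈ ∃ᵈ (∃ᵈ (∃ᵈ (∃ᵈ (IsOrᵈ (4 ↑ʳ φ) v₃ v₂ ×ᵈ
          ⟨ v₃ , v₁ ⟩∈ᵈ (4 ↑ʳ r) ×ᵈ ⟨ v₂ , v₀ ⟩∈ᵈ (4 ↑ʳ r) ×ᵈ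
          ∀ᵈ (v₀ ∈ᵈ 5 ↑ʳ f ⇔ᵈ v₀ ∈ᵈ v₂ ⊎ᵈ v₀ ∈ᵈ v₁)))))
    ⊎ᵈ ∃ᵈ (∃ᵈ (∃ᵈ (IsExᵈ (3 ↑ʳ φ) v₂ v₁ ×ᵈ ⟨ v₁ , v₀ ⟩∈ᵈ (3 ↑ʳ r) ×ᵈ
          ∀ᵈ (v₀ ∈ᵈ 4 ↑ʳ f ⇔ᵈ v₀ ∈ᵈ v₁ ×ᵈ ¬ᵈ v₀ ≡ᵈ v₃))))

  HasFreeVarsᵈ : (φ f : Fin n) → Definable (λ a → HasFreeVars M (lookup a φ) (lookup a f))
  HasFreeVarsᵈ φ f =
    ∃ᵈ (⟨ 1 ↑ʳ φ , 1 ↑ʳ f ⟩∈ᵈ v₀ ×ᵈ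
        ∀ᵈ (∀ᵈ (⟨ v₁ , v₀ ⟩∈ᵈ v₂ →ᵈ FreeVarsStepᵈ v₂ v₁ v₀)))

  IsAssignmentᵈ : (s : Fin n) → Definable (λ a → IsAssignment M (lookup a s))
  IsAssignmentᵈ s =
    ∀ᵈ (v₀ ∈ᵈ 1 ↑ʳ s →ᵈ ∃ᵈ (∃ᵈ (IsFiniteOrdinalᵈ v₁ ×ᵈ IsPairᵈ v₂ v₁ v₀))) ×ᵈ
    ∀ᵈ (∀ᵈ (∀ᵈ (⟨ v₂ , v₁ ⟩∈ᵈ (3 ↑ʳ s) →ᵈ ⟨ v₂ , v₀ ⟩∈ᵈ (3 ↑ʳ s) →ᵈ v₁ ≡ᵈ v₀)))

  IsTermSubstᵈ : (s t t′ : Fin n) →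
                 Definable (λ a → IsTermSubst M (lookup a s) (lookup a t) (lookup a t′))
  IsTermSubstᵈ s t t′ =
       ∃ᵈ (∃ᵈ (IsVarᵈ (2 ↑ʳ t) v₁ ×ᵈ ⟨ v₁ , v₀ ⟩∈ᵈ (2 ↑ʳ s) ×ᵈ IsConstᵈ (2 ↑ʳ t′) v₀))
    ⊎ᵈ ∃ᵈ (IsVarᵈ (1 ↑ʳ t) v₀ ×ᵈ ∀ᵈ (¬ᵈ (⟨ v₁ , v₀ ⟩∈ᵈ (2 ↑ʳ s))) ×ᵈ 1 ↑ʳ t′ ≡ᵈ 1 ↑ʳ t)
    ⊎ᵈ ∃ᵈ (IsConstᵈ (1 ↑ʳ t) v₀ ×ᵈ 1 ↑ʳ t′ ≡ᵈ 1 ↑ʳ t)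

  IsWithoutᵈ : (s′ s i : Fin n) →
               Definable (λ a → IsWithout M (lookup a s′) (lookup a s) (lookup a i))
  IsWithoutᵈ s′ s i =
    ∀ᵈ (v₀ ∈ᵈ 1 ↑ʳ s′ ⇔ᵈ v₀ ∈ᵈ 1 ↑ʳ s ×ᵈ ¬ᵈ ∃ᵈ (IsPairᵈ v₁ (2 ↑ʳ i) v₀))

  ⟨_∣_∣_⟩∈ᵈ_ : (s x y r : Fin n) →
    Definable (λ a → ⟨_∣_∣_⟩∈_ M (lookup a s) (lookup a x) (lookup a y) (lookup a r))
  ⟨ s ∣ x ∣ y ⟩∈ᵈ r = ∃ᵈ (IsPairᵈ v₀ (1 ↑ʳ x) (1 ↑ʳ y) ×ᵈ ⟨ 1 ↑ʳ s , v₀ ⟩∈ᵈ (1 ↑ʳ r))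

  SubstStepᵈ : (r s φ χ : Fin n) → Definable (λ a →
    SubstStep M (lookup a r) (lookup a s) (lookup a φ) (lookup a χ))
  SubstStepᵈ r s φ χ =
       ∃ᵈ (∃ᵈ (∃ᵈ (∃ᵈ (IsTermSubstᵈ (4 ↑ʳ s) v₃ v₁ ×ᵈ IsTermSubstᵈ (4 ↑ʳ s) v₂ v₀ ×ᵈ
          ((IsEqᵈ (4 ↑ʳ φ) v₃ v₂ ×ᵈ IsEqᵈ (4 ↑ʳ χ) v₁ v₀) ⊎ᵈ
           (IsMemᵈ (4 ↑ʳ φ) v₃ v₂ ×ᵈ IsMemᵈ (4 ↑ʳ χ) v₁ v₀))))))
    ⊎ᵈ ∃ᵈ (∃ᵈ (IsNegᵈ (2 ↑ʳ φ) v₁ ×ᵈ IsNegᵈ (2 ↑ʳ χ) v₀ ×ᵈ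
          ⟨ 2 ↑ʳ s ∣ v₁ ∣ v₀ ⟩∈ᵈ (2 ↑ʳ r)))
    ⊎ᵈ ∃ᵈ (∃ᵈ (∃ᵈ (∃ᵈ (IsOrᵈ (4 ↑ʳ φ) v₃ v₂ ×ᵈ IsOrᵈ (4 ↑ʳ χ) v₁ v₀ ×ᵈ
          ⟨ 4 ↑ʳ s ∣ v₃ ∣ v₁ ⟩∈ᵈ (4 ↑ʳ r) ×ᵈ ⟨ 4 ↑ʳ s ∣ v₂ ∣ v₀ ⟩∈ᵈ (4 ↑ʳ r)))))
    ⊎ᵈ ∃ᵈ (∃ᵈ (∃ᵈ (∃ᵈ (IsExᵈ (4 ↑ʳ φ) v₃ v₂ ×ᵈ IsExᵈ (4 ↑ʳ χ) v₃ v₁ ×ᵈ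
          IsWithoutᵈ v₀ (4 ↑ʳ s) v₃ ×ᵈ ⟨ v₀ ∣ v₂ ∣ v₁ ⟩∈ᵈ (4 ↑ʳ r)))))

  IsSubstᵈ : (s φ χ : Fin n) →
             Definable (λ a → IsSubst M (lookup a s) (lookup a φ) (lookup a χ))
  IsSubstᵈ s φ χ =
    ∃ᵈ (⟨ 1 ↑ʳ s ∣ 1 ↑ʳ φ ∣ 1 ↑ʳ χ ⟩∈ᵈ v₀ ×ᵈ
        ∀ᵈ (∀ᵈ (∀ᵈ (⟨ v₂ ∣ v₁ ∣ v₀ ⟩∈ᵈ v₃ →ᵈ SubstStepᵈ v₃ v₂ v₁ v₀))))

  IsInstanceᵈ : (i a ψ χ : Fin n) → Definable (λ v →
    IsInstance M (lookup v i) (lookup v a) (lookup v ψ) (lookup v χ))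
  IsInstanceᵈ i a ψ χ =
    ∃ᵈ (∃ᵈ (IsPairᵈ v₀ (2 ↑ʳ i) (2 ↑ʳ a) ×ᵈ IsUPairᵈ v₁ v₀ v₀ ×ᵈ
            IsSubstᵈ v₁ (2 ↑ʳ ψ) (2 ↑ʳ χ)))

  IsInstance₂ᵈ : (b a φ χ : Fin n) → Definable (λ v →
    IsInstance₂ M (lookup v b) (lookup v a) (lookup v φ) (lookup v χ))
  IsInstance₂ᵈ b a φ χ =
    ∃ᵈ (∃ᵈ (∃ᵈ (∃ᵈ (∃ᵈ (IsNumeralᵈ 0 v₃ ×ᵈ IsNumeralᵈ 1 v₂ ×ᵈ
      IsPairᵈ v₁ v₃ (5 ↑ʳ b) ×ᵈ IsPairᵈ v₀ v₂ (5 ↑ʳ a) ×ᵈ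
      IsUPairᵈ v₄ v₁ v₀ ×ᵈ IsSubstᵈ v₄ (5 ↑ʳ φ) (5 ↑ʳ χ))))))

  IsSentenceOfDepthᵈ : (χ d : Fin n) →
                       Definable (λ a → IsSentenceOfDepth M (lookup a χ) (lookup a d))
  IsSentenceOfDepthᵈ χ d =
    ∃ᵈ (∃ᵈ (∃ᵈ (HasDepthᵈ v₂ (3 ↑ʳ d) ×ᵈ HasFreeVarsᵈ v₂ v₁ ×ᵈ IsAssignmentᵈ v₀ ×ᵈ
      ∀ᵈ (v₀ ∈ᵈ v₂ →ᵈ ∃ᵈ (⟨ v₁ , v₀ ⟩∈ᵈ v₂)) ×ᵈ IsSubstᵈ v₀ v₂ (3 ↑ʳ χ))))

  IsDepthSentenceᵈ : (k χ : Fin n) →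
                     Definable (λ a → IsDepthSentence M (lookup a k) (lookup a χ))
  IsDepthSentenceᵈ k χ =
    ∃ᵈ (v₀ ≤ᵒᵈ (1 ↑ʳ k) ×ᵈ IsSentenceOfDepthᵈ (1 ↑ʳ χ) v₀)

-- Pairs, numerals and assignments inside M.

module SetTheory {ℓ ℓ′ : Level} (em : ExcludedMiddle ℓ) (M : SetStructure ℓ)
                 (𝔛 : Classes M ℓ′) (gb : GBCore M 𝔛) where
  open SetStructure M
  open Classes 𝔛
  open GBCore gb
  open Definability em M

  private variable
    a b i p q r s x x′ y y′ z : V
    m n : ℕ

  ∅ : V
  ∅ = proj₁ emptySet

  ∉∅ : ¬ x ∈ ∅
  ∉∅ = proj₂ emptySet _

  infix 6 _∪_
  infix 4 _⊆_

  _⊆_ : V → V → Set ℓ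
  _⊆_ = _⊆ˢ_ M

  ⟅_,_⟆ ⟪_,_⟫ _∪_ : V → V → V
  ⟅ x , y ⟆ = proj₁ (pairing x y)
  ⟪ x , y ⟫ = ⟅ ⟅ x , x ⟆ , ⟅ x , y ⟆ ⟆
  x ∪ y = proj₁ (union ⟅ x , y ⟆)

  ⟅_⟆₁ suc* : V → V
  ⟅ x ⟆₁ = ⟅ x , x ⟆
  suc* x = x ∪ ⟅ x ⟆₁

  ⊆-antisym : x ⊆ y → y ⊆ x → x ≡ y
  ⊆-antisym x⊆y y⊆x = extensionality _ _ λ z → mk⇔ (x⊆y z) (y⊆x z)

  ∈-⟅⟆ : z ∈ ⟅ x , y ⟆ ⇔ (z ≡ x ⊎ z ≡ y)
  ∈-⟅⟆ = proj₂ (pairing _ _) _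

  x∈⟅x,y⟆ : x ∈ ⟅ x , y ⟆
  x∈⟅x,y⟆ = from ∈-⟅⟆ (inj₁ refl)

  y∈⟅x,y⟆ : y ∈ ⟅ x , y ⟆
  y∈⟅x,y⟆ = from ∈-⟅⟆ (inj₂ refl)

  ∈-⟅⟆₁ : z ∈ ⟅ x ⟆₁ → z ≡ x
  ∈-⟅⟆₁ = [ id , id ]′ ∘ to ∈-⟅⟆

  ∈-∪ : z ∈ x ∪ y ⇔ (z ∈ x ⊎ z ∈ y)
  ∈-∪ = mk⇔
    (λ h → case (to (proj₂ (union _) _) h))
    [ (λ h → from (proj₂ (union _) _) (_ , h , x∈⟅x,y⟆))
    , (λ h → from (proj₂ (union _) _) (_ , h , y∈⟅x,y⟆)) ]′
    where
    case : ∃ (λ w → z ∈ w × w ∈ ⟅ x , y ⟆) → z ∈ x ⊎ z ∈ y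
    case (w , z∈w , w∈) with to ∈-⟅⟆ w∈
    ... | inj₁ refl = inj₁ z∈w
    ... | inj₂ refl = inj₂ z∈w

  ∪-⊆ˡ : x ⊆ x ∪ y
  ∪-⊆ˡ z h = from ∈-∪ (inj₁ h)

  ∪-⊆ʳ : y ⊆ x ∪ y
  ∪-⊆ʳ z h = from ∈-∪ (inj₂ h)

  IsEmpty⇒≡ : IsEmpty M x → x ≡ ∅
  IsEmpty⇒≡ e = ⊆-antisym (λ z h → ⊥-elim (e z h)) (λ z h → ⊥-elim (∉∅ h))

  IsUPair⇒≡ : IsUPair M p x y → p ≡ ⟅ x , y ⟆
  IsUPair⇒≡ h = extensionality _ _ λ z → h z ⨾ ⇔.sym ∈-⟅⟆

  IsPair⇒≡ : IsPair M p x y → p ≡ ⟪ x , y ⟫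
  IsPair⇒≡ (u , v , hu , hv , hp) with refl ← IsUPair⇒≡ hu | refl ← IsUPair⇒≡ hv = IsUPair⇒≡ hp

  ⟪⟫-isPair : IsPair M ⟪ x , y ⟫ x y
  ⟪⟫-isPair = _ , _ , (λ z → ∈-⟅⟆) , (λ z → ∈-⟅⟆) , (λ z → ∈-⟅⟆)

  IsSuc⇒≡ : IsSuc M y x → y ≡ suc* x
  IsSuc⇒≡ h = extensionality _ _ λ z →
    h z ⨾ ⇔.refl ⊎-⇔ mk⇔ (from ∈-⟅⟆ ∘ inj₁) ∈-⟅⟆₁ ⨾ ⇔.sym ∈-∪

  suc*-isSuc : IsSuc M (suc* x) x
  suc*-isSuc z = ∈-∪ ⨾ ⇔.refl ⊎-⇔ mk⇔ ∈-⟅⟆₁ (from ∈-⟅⟆ ∘ inj₁)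

  ⟅⟆-injective : ⟅ x , y ⟆ ≡ ⟅ x′ , y′ ⟆ → (x ≡ x′ × y ≡ y′) ⊎ (x ≡ y′ × y ≡ x′)
  ⟅⟆-injective {x} {y} {x′} {y′} e
    with to ∈-⟅⟆ (subst (x ∈_) e x∈⟅x,y⟆) | to ∈-⟅⟆ (subst (y ∈_) e y∈⟅x,y⟆)
       | to ∈-⟅⟆ (subst (x′ ∈_) (sym e) x∈⟅x,y⟆) | to ∈-⟅⟆ (subst (y′ ∈_) (sym e) y∈⟅x,y⟆)
  ... | inj₁ refl | inj₂ refl | _ | _ = inj₁ (refl , refl)
  ... | inj₂ refl | inj₁ refl | _ | _ = inj₂ (refl , refl)
  ... | inj₁ refl | inj₁ refl | _ | inj₁ refl = inj₁ (refl , refl)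
  ... | inj₁ refl | inj₁ refl | _ | inj₂ refl = inj₁ (refl , refl)
  ... | inj₂ refl | inj₂ refl | inj₁ refl | _ = inj₁ (refl , refl)
  ... | inj₂ refl | inj₂ refl | inj₂ refl | _ = inj₁ (refl , refl)

  ⟪⟫-injective : ⟪ x , y ⟫ ≡ ⟪ x′ , y′ ⟫ → x ≡ x′ × y ≡ y′
  ⟪⟫-injective e with ⟅⟆-injective e
  ... | inj₁ (e₁ , e₂) with ⟅⟆-injective e₁ | ⟅⟆-injective e₂
  ...   | _                | inj₁ (refl , refl) = refl , refl
  ...   | inj₁ (refl , _)  | inj₂ (refl , refl) = refl , refl
  ...   | inj₂ (refl , _)  | inj₂ (refl , refl) = refl , refl
  ⟪⟫-injective e | inj₂ (e₁ , e₂) with ⟅⟆-injective e₁ | ⟅⟆-injective e₂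
  ...   | inj₁ (refl , refl) | inj₁ (_ , refl) = refl , refl
  ...   | inj₁ (refl , refl) | inj₂ (_ , refl) = refl , refl
  ...   | inj₂ (refl , refl) | inj₁ (_ , refl) = refl , refl
  ...   | inj₂ (refl , refl) | inj₂ (_ , refl) = refl , refl

  ⟨⟩∈⇔ : ⟨_,_⟩∈_ M x y r ⇔ ⟪ x , y ⟫ ∈ r
  ⟨⟩∈⇔ = mk⇔ (λ (p , h , p∈r) → subst (_∈ _) (IsPair⇒≡ h) p∈r) (λ h → _ , ⟪⟫-isPair , h)

  definable⇒class : ∀ {P : Vec V (suc n) → Set ℓ} → Definable P → ∀ v → IsClass (λ x → P (x ∷ v))
  definable⇒class (φ by c) v =
    respects ((λ {x} → to (c (x ∷ v))) , λ {x} → from (c (x ∷ v))) (comprehension φ v [] [])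

  -- Replacement for the identity function restricted to P.
  separation : ∀ {P : Vec V (suc n) → Set ℓ} → Definable P → ∀ v a →
               ∃[ b ] ∀ x → x ∈ b ⇔ (x ∈ a × P (x ∷ v))
  separation {n} {P} dP v a = proj₁ image , λ x → proj₂ image x ⨾ mk⇔
      (λ (x′ , x′∈a , p , hp , y , hy , Py) → restrict (IsPair⇒≡ hp) (IsPair⇒≡ hy) x′∈a (to (P⇔ y p) Py))
      (λ (x∈a , Px) → x , x∈a , _ , ⟪⟫-isPair , x , ⟪⟫-isPair , from (P⇔ x ⟪ x , x ⟫) Px)
    where
    -- Under the quantifier in `F` the context is `x ∷ p ∷ v`; this renaming skips the pair `p`.
    ρ : Fin (suc n) → Fin (suc (suc n))
    ρ zero    = zero
    ρ (suc i) = suc (suc i)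

    P⇔ : ∀ x p → P (tabulate (lookup (x ∷ p ∷ v) ∘ ρ)) ⇔ P (x ∷ v)
    P⇔ x p = mk⇔ (subst P (cong (x ∷_) (tabulate∘lookup v)))
               (subst P (sym (cong (x ∷_) (tabulate∘lookup v))))

    F : Pred V ℓ
    F p = ∃[ x ] IsPair M p x x × P (tabulate (lookup (x ∷ p ∷ v) ∘ ρ))

    F-isClass : IsClass F
    F-isClass = definable⇒class (∃ᵈ (IsPairᵈ v₁ v₀ v₀ ×ᵈ renameᵈ ρ dP)) v

    restrict : ∀ {x′ x y p} → p ≡ ⟪ x′ , x ⟫ → p ≡ ⟪ y , y ⟫ → x′ ∈ a → P (y ∷ v) → x ∈ a × P (x ∷ v)
    restrict refl e x′∈a Py with refl , refl ← ⟪⟫-injective e = x′∈a , Py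

    F-functional : ∀ x y z p q → IsPair M p x y → IsPair M q x z → F p → F q → y ≡ z
    F-functional x y z p q hp hq (_ , hp′ , _) (_ , hq′ , _)
      with refl , refl ← ⟪⟫-injective (trans (sym (IsPair⇒≡ hp)) (IsPair⇒≡ hp′))
         | refl , refl ← ⟪⟫-injective (trans (sym (IsPair⇒≡ hq)) (IsPair⇒≡ hq′)) = refl

    image : ∃[ b ] ∀ y → y ∈ b ⇔ (∃[ x ] x ∈ a × (∃[ p ] IsPair M p x y × F p))
    image = replacement F F-isClass F-functional a

  ∈-irrefl : ¬ x ∈ x
  ∈-irrefl {x} h with y , y∈ , min ← foundation ⟅ x ⟆₁ (x , x∈⟅x,y⟆)
    with refl ← ∈-⟅⟆₁ y∈ = min x h x∈⟅x,y⟆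

  num : ℕ → V
  num zero    = ∅
  num (suc n) = suc* (num n)

  IsNumeral⇒≡ : ∀ n → IsNumeral M n x → x ≡ num n
  IsNumeral⇒≡ zero    e = IsEmpty⇒≡ e
  IsNumeral⇒≡ (suc n) (y , hy , hs) with refl ← IsNumeral⇒≡ n hy = IsSuc⇒≡ hs

  num-isNumeral : ∀ n → IsNumeral M n (num n)
  num-isNumeral zero    = proj₂ emptySet
  num-isNumeral (suc n) = num n , num-isNumeral n , suc*-isSuc

  ∈-num : ∀ n → x ∈ num n → ∃[ m ] m < n × x ≡ num m
  ∈-num zero    h = ⊥-elim (∉∅ h)
  ∈-num (suc n) h with to ∈-∪ h
  ... | inj₁ h with m , m<n , e ← ∈-num n h = m , m<n⇒m<1+n m<n , e
  ... | inj₂ h = n , n<1+n n , ∈-⟅⟆₁ h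

  num-<⇒∈ : m < n → num m ∈ num n
  num-<⇒∈ {m} {suc n} m<1+n with m<1+n⇒m<n∨m≡n m<1+n
  ... | inj₁ m<n  = from ∈-∪ (inj₁ (num-<⇒∈ m<n))
  ... | inj₂ refl = from ∈-∪ (inj₂ x∈⟅x,y⟆)

  num-injective : num m ≡ num n → m ≡ n
  num-injective {m} {n} e with <-cmp m n
  ... | tri< m<n _ _ = ⊥-elim (∈-irrefl (subst (num m ∈_) (sym e) (num-<⇒∈ m<n)))
  ... | tri≈ _ m≡n _ = m≡n
  ... | tri> _ _ n<m = ⊥-elim (∈-irrefl (subst (num n ∈_) e (num-<⇒∈ n<m)))

  num-transitive : ∀ n → Transitive M (num n)
  num-transitive n y y∈ z z∈ with m , m<n , refl ← ∈-num n y∈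
    with k , k<m , refl ← ∈-num m z∈ = num-<⇒∈ (<-trans k<m m<n)

  num-isFiniteOrdinal : ∀ n → IsFiniteOrdinal M (num n)
  num-isFiniteOrdinal n = (num-transitive n , elem) , pred
    where
    elem : ∀ y → y ∈ num n → Transitive M y
    elem y y∈ with m , _ , refl ← ∈-num n y∈ = num-transitive m

    zero-or-suc : ∀ m → IsEmpty M (num m) ⊎ (∃[ z ] IsSuc M (num m) z)
    zero-or-suc zero    = inj₁ (proj₂ emptySet)
    zero-or-suc (suc m) = inj₂ (num m , suc*-isSuc)

    pred : ∀ y → _≤ᵒ_ M y (num n) → IsEmpty M y ⊎ (∃[ z ] IsSuc M y z)
    pred y (inj₁ y∈) with m , _ , refl ← ∈-num n y∈ = zero-or-suc m
    pred y (inj₂ refl) = zero-or-suc n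

  ∈-isFiniteOrdinal : IsFiniteOrdinal M x → y ∈ x → IsFiniteOrdinal M y
  ∈-isFiniteOrdinal ((x-tr , x-el) , x-pred) y∈x =
    (x-el _ y∈x , λ z z∈y → x-el z (x-tr _ y∈x z z∈y)) ,
    λ z → λ where
      (inj₁ z∈y)  → x-pred z (inj₁ (x-tr _ y∈x z z∈y))
      (inj₂ refl) → x-pred z (inj₁ y∈x)

  ∈-≤ᵒ-trans : IsFiniteOrdinal M z → x ∈ y → _≤ᵒ_ M y z → x ∈ z
  ∈-≤ᵒ-trans ((z-tr , _) , _) x∈y (inj₁ y∈z)  = z-tr _ y∈z _ x∈y
  ∈-≤ᵒ-trans _                x∈y (inj₂ refl) = x∈y

  ≤ᵒ-∈-trans : IsFiniteOrdinal M z → _≤ᵒ_ M x y → y ∈ z → x ∈ z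
  ≤ᵒ-∈-trans ((z-tr , _) , _) (inj₁ x∈y)  y∈z = z-tr _ y∈z _ x∈y
  ≤ᵒ-∈-trans _                (inj₂ refl) y∈z = y∈z

  IsSuc⇒∈ : IsSuc M y x → x ∈ y
  IsSuc⇒∈ h = from (h _) (inj₂ refl)

  ∈-suc*⇒≤ᵒ : x ∈ suc* y → _≤ᵒ_ M x y
  ∈-suc*⇒≤ᵒ = map₂ ∈-⟅⟆₁ ∘ to ∈-∪

  IsTagged⇒≡ : IsTagged M n x y → x ≡ ⟪ num n , y ⟫
  IsTagged⇒≡ {n} (k , hk , hx) with refl ← IsNumeral⇒≡ n hk = IsPair⇒≡ hx

  tagged : ∀ n → IsTagged M n ⟪ num n , y ⟫ y
  tagged n = num n , num-isNumeral n , ⟪⟫-isPair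

  IsTagged-unique : IsTagged M m x y → IsTagged M n x z → m ≡ n × y ≡ z
  IsTagged-unique h h′ with e , refl ← ⟪⟫-injective (trans (sym (IsTagged⇒≡ h)) (IsTagged⇒≡ h′))
    = num-injective e , refl

  without : ∀ s i → ∃[ s′ ] IsWithout M s′ s i
  without s i = separation (¬ᵈ ∃ᵈ (IsPairᵈ v₁ v₂ v₀)) (i ∷ []) s

  ∈-without : IsWithout M s x i → ⟪ y , z ⟫ ∈ s ⇔ (⟪ y , z ⟫ ∈ x × y ≢ i)
  ∈-without w = w _ ⨾ ⇔.refl ×-⇔ ¬-cong-⇔ (mk⇔
    (λ (_ , h) → proj₁ (⟪⟫-injective (IsPair⇒≡ h)))
    (λ where refl → _ , ⟪⟫-isPair))

  -- An assignment may already have a value at `i`, since values outside the free variables are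
  -- arbitrary. Hence the old pairs at `i` are removed before the new one is added.
  IsUpdate : V → V → V → V → Set ℓ
  IsUpdate t s i a = ∀ p → p ∈ t ⇔ ((p ∈ s × ¬ (∃[ b ] IsPair M p i b)) ⊎ p ≡ ⟪ i , a ⟫)

  update : ∀ s i a → ∃[ t ] IsUpdate t s i a
  update s i a with s′ , hs′ ← without s i =
    s′ ∪ ⟅ ⟪ i , a ⟫ ⟆₁ , λ p → ∈-∪ ⨾ hs′ p ⊎-⇔ mk⇔ ∈-⟅⟆₁ (from ∈-⟅⟆ ∘ inj₁)

  ∈-update : IsUpdate r s i a → ⟪ y , z ⟫ ∈ r ⇔ ((⟪ y , z ⟫ ∈ s × y ≢ i) ⊎ (y ≡ i × z ≡ a))
  ∈-update u = u _ ⨾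
    (⇔.refl ×-⇔ ¬-cong-⇔ (mk⇔
      (λ (_ , h) → proj₁ (⟪⟫-injective (IsPair⇒≡ h)))
      (λ where refl → _ , ⟪⟫-isPair)))
    ⊎-⇔ mk⇔ ⟪⟫-injective (λ where (refl , refl) → refl)

  update-isAssignment : IsFiniteOrdinal M i → IsAssignment M s → IsUpdate r s i a → IsAssignment M r
  update-isAssignment {i} {s} {r} {a} ωi (dom , fun) u = dom′ , fun′
    where
    dom′ : ∀ p → p ∈ r → ∃[ j ] ∃[ b ] IsFiniteOrdinal M j × IsPair M p j b
    dom′ p p∈ with to (u p) p∈
    ... | inj₁ (p∈s , _) = dom p p∈s
    ... | inj₂ refl      = i , a , ωi , ⟪⟫-isPair

    fun′ : ∀ j b c → ⟨_,_⟩∈_ M j b r → ⟨_,_⟩∈_ M j c r → b ≡ c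
    fun′ j b c h h′ with to (∈-update u) (to ⟨⟩∈⇔ h) | to (∈-update u) (to ⟨⟩∈⇔ h′)
    ... | inj₁ (h , _)       | inj₁ (h′ , _)      = fun j b c (from ⟨⟩∈⇔ h) (from ⟨⟩∈⇔ h′)
    ... | inj₁ (_ , j≢i)     | inj₂ (refl , _)    = contradiction refl j≢i
    ... | inj₂ (refl , _)    | inj₁ (_ , j≢i)     = contradiction refl j≢i
    ... | inj₂ (_ , refl)    | inj₂ (_ , refl)    = refl

-- Coded formulas and the recursions on them.

module Syntax {ℓ ℓ′ : Level} (em : ExcludedMiddle ℓ) (M : SetStructure ℓ)
              (𝔛 : Classes M ℓ′) (gb : GBCore M 𝔛) where
  open SetStructure M
  open Definability em M
  open SetTheory em M 𝔛 gb

  private variable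
    a b c d f i k r s t t′ u x x′ y y′ z φ χ ψ : V
    m n : ℕ

  -- The immediate structure of a code: Kuratowski codes carry no visible
  -- constructor, so all case distinctions go through head-unique.
  data Head : Set ℓ where
    eq mem or ex : V → V → Head
    neg          : V → Head

  private variable
    h h′ : Head

  IsHead : V → Head → Set ℓ
  IsHead x (eq t u)  = IsEq M x t u
  IsHead x (mem t u) = IsMem M x t u
  IsHead x (neg ψ)   = IsNeg M x ψ
  IsHead x (or ψ χ)  = IsOr M x ψ χ
  IsHead x (ex i ψ)  = IsEx M x i ψ

  tag : Head → ℕ
  tag (eq _ _)  = 0
  tag (mem _ _) = 1
  tag (neg _)   = 2
  tag (or _ _)  = 3
  tag (ex _ _)  = 4

  body : Head → V
  body (eq t u)  = ⟪ t , u ⟫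
  body (mem t u) = ⟪ t , u ⟫
  body (neg ψ)   = ψ
  body (or ψ χ)  = ⟪ ψ , χ ⟫
  body (ex i ψ)  = ⟪ i , ψ ⟫

  code : Head → V
  code h = ⟪ num (tag h) , body h ⟫

  tagged-pair : ∀ n → ∃[ p ] IsPair M p x y × IsTagged M n ⟪ num n , ⟪ x , y ⟫ ⟫ p
  tagged-pair n = _ , ⟪⟫-isPair , tagged n

  IsTaggedPair⇒≡ : ∀ n → ∃[ p ] IsPair M p x y × IsTagged M n z p → z ≡ ⟪ num n , ⟪ x , y ⟫ ⟫
  IsTaggedPair⇒≡ n (p , hp , ht) with refl ← IsPair⇒≡ hp = IsTagged⇒≡ ht

  IsHead⇒≡ : ∀ h → IsHead x h → x ≡ code h
  IsHead⇒≡ (eq t u)  e       = IsTaggedPair⇒≡ 0 e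
  IsHead⇒≡ (mem t u) e       = IsTaggedPair⇒≡ 1 e
  IsHead⇒≡ (neg ψ)   e       = IsTagged⇒≡ e
  IsHead⇒≡ (or ψ χ)  e       = IsTaggedPair⇒≡ 3 e
  IsHead⇒≡ (ex i ψ)  (_ , e) = IsTaggedPair⇒≡ 4 e

  tag-body-injective : ∀ h h′ → tag h ≡ tag h′ → body h ≡ body h′ → h ≡ h′
  tag-body-injective (eq _ _)  (eq _ _)  refl e = let e₁ , e₂ = ⟪⟫-injective e in cong₂ eq e₁ e₂
  tag-body-injective (mem _ _) (mem _ _) refl e = let e₁ , e₂ = ⟪⟫-injective e in cong₂ mem e₁ e₂
  tag-body-injective (neg _)   (neg _)   refl e = cong neg e
  tag-body-injective (or _ _)  (or _ _)  refl e = let e₁ , e₂ = ⟪⟫-injective e in cong₂ or e₁ e₂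
  tag-body-injective (ex _ _)  (ex _ _)  refl e = let e₁ , e₂ = ⟪⟫-injective e in cong₂ ex e₁ e₂

  -- Pairing is injective and distinct natural numbers have distinct numerals, so a code determines
  -- its tag and its body.
  head-unique : IsHead x h → IsHead x h′ → h ≡ h′
  head-unique {h = h} {h′} p q
    with e₁ , e₂ ← ⟪⟫-injective (trans (sym (IsHead⇒≡ h p)) (IsHead⇒≡ h′ q))
    = tag-body-injective h h′ (num-injective e₁) e₂

  IsVar⇒≡ : IsVar M t i → t ≡ ⟪ ∅ , i ⟫
  IsVar⇒≡ (_ , e) = IsTagged⇒≡ e

  IsVar-unique : IsVar M t i → IsVar M t k → i ≡ k
  IsVar-unique (_ , e) (_ , e′) = proj₂ (IsTagged-unique e e′)

  IsConst-unique : IsConst M t a → IsConst M t b → a ≡ b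
  IsConst-unique e e′ = proj₂ (IsTagged-unique e e′)

  ¬IsVar×IsConst : IsVar M t i → ¬ IsConst M t a
  ¬IsVar×IsConst (_ , e) e′ with () ← proj₁ (IsTagged-unique e e′)

  -- Recursions in the sense of M unfold and fold by one step, so that any
  -- property of codes of standard depth can be proved by external induction.
  module Recursion (Step : V → V → V → Set ℓ)
                   (mono : ∀ {r r′ x y} → r ⊆ r′ → Step r x y → Step r′ x y) where

    Rec : V → V → Set ℓ
    Rec x y = ∃[ r ] ⟨_,_⟩∈_ M x y r × (∀ x y → ⟨_,_⟩∈_ M x y r → Step r x y)

    unfold : Rec x y → ∃[ r ] Step r x y × (∀ {x′ y′} → ⟨_,_⟩∈_ M x′ y′ r → Rec x′ y′)
    unfold (r , h , closed) = r , closed _ _ h , λ h′ → r , h′ , closed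

    private
      -- A closed set stays closed when one justified pair is added, because monotonicity keeps the
      -- old justifications valid. For a formula with two parts the closed sets of both are united
      -- first.
      extend : (∀ x y → ⟨_,_⟩∈_ M x y r → Step r x y) → Step r x y → Rec x y
      extend {r} {x} {y} closed step = r′ , from ⟨⟩∈⇔ (∪-⊆ʳ _ x∈⟅x,y⟆) , closed′
        where
        r′ = r ∪ ⟅ ⟪ x , y ⟫ ⟆₁

        closed′ : ∀ x′ y′ → ⟨_,_⟩∈_ M x′ y′ r′ → Step r′ x′ y′
        closed′ x′ y′ h with to ∈-∪ (to ⟨⟩∈⇔ h)
        ... | inj₁ h′ = mono ∪-⊆ˡ (closed x′ y′ (from ⟨⟩∈⇔ h′))
        ... | inj₂ h′ with refl , refl ← ⟪⟫-injective (∈-⟅⟆₁ h′) = mono ∪-⊆ˡ step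

    fold₀ : Step ∅ x y → Rec x y
    fold₀ = extend λ x y h → ⊥-elim (∉∅ (to ⟨⟩∈⇔ h))

    fold₁ : Rec x y → (∀ {r} → ⟪ x , y ⟫ ∈ r → Step r x′ y′) → Rec x′ y′
    fold₁ (r , h , closed) step = extend closed (step (to ⟨⟩∈⇔ h))

    fold₂ : ∀ {x₁ y₁ x₂ y₂} → Rec x₁ y₁ → Rec x₂ y₂ →
            (∀ {r} → ⟪ x₁ , y₁ ⟫ ∈ r → ⟪ x₂ , y₂ ⟫ ∈ r → Step r x y) → Rec x y
    fold₂ (r₁ , h₁ , c₁) (r₂ , h₂ , c₂) step =
      extend (λ x y h → [ mono ∪-⊆ˡ ∘ c₁ x y ∘ from ⟨⟩∈⇔ , mono ∪-⊆ʳ ∘ c₂ x y ∘ from ⟨⟩∈⇔ ]′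
                          (to ∈-∪ (to ⟨⟩∈⇔ h)))
             (step (∪-⊆ˡ _ (to ⟨⟩∈⇔ h₁)) (∪-⊆ʳ _ (to ⟨⟩∈⇔ h₂)))

  ⟨⟩∈-mono : r ⊆ s → ⟨_,_⟩∈_ M x y r → ⟨_,_⟩∈_ M x y s
  ⟨⟩∈-mono r⊆s (p , hp , p∈r) = p , hp , r⊆s p p∈r

  DepthStep-mono : r ⊆ s → DepthStep M r x y → DepthStep M s x y
  DepthStep-mono sub (inj₁ h) = inj₁ h
  DepthStep-mono sub (inj₂ (inj₁ (ψ , e , h , h₁ , hs))) =
    inj₂ (inj₁ (ψ , e , h , ⟨⟩∈-mono sub h₁ , hs))
  DepthStep-mono sub (inj₂ (inj₂ (inj₁ (ψ₁ , ψ₂ , e₁ , e₂ , m , h , h₁ , h₂ , hs)))) =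
    inj₂ (inj₂ (inj₁ (ψ₁ , ψ₂ , e₁ , e₂ , m , h , ⟨⟩∈-mono sub h₁ , ⟨⟩∈-mono sub h₂ , hs)))
  DepthStep-mono sub (inj₂ (inj₂ (inj₂ (i , ψ , e , h , h₁ , hs)))) =
    inj₂ (inj₂ (inj₂ (i , ψ , e , h , ⟨⟩∈-mono sub h₁ , hs)))

  FreeVarsStep-mono : r ⊆ s → FreeVarsStep M r x y → FreeVarsStep M s x y
  FreeVarsStep-mono sub (inj₁ h) = inj₁ h
  FreeVarsStep-mono sub (inj₂ (inj₁ (ψ , h , h₁))) = inj₂ (inj₁ (ψ , h , ⟨⟩∈-mono sub h₁))
  FreeVarsStep-mono sub (inj₂ (inj₂ (inj₁ (ψ₁ , ψ₂ , f₁ , f₂ , h , h₁ , h₂ , hf)))) =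
    inj₂ (inj₂ (inj₁ (ψ₁ , ψ₂ , f₁ , f₂ , h , ⟨⟩∈-mono sub h₁ , ⟨⟩∈-mono sub h₂ , hf)))
  FreeVarsStep-mono sub (inj₂ (inj₂ (inj₂ (i , ψ , g , h , h₁ , hf)))) =
    inj₂ (inj₂ (inj₂ (i , ψ , g , h , ⟨⟩∈-mono sub h₁ , hf)))

  ⟨∣∣⟩∈-mono : r ⊆ s → ⟨_∣_∣_⟩∈_ M t x y r → ⟨_∣_∣_⟩∈_ M t x y s
  ⟨∣∣⟩∈-mono r⊆s (p , hp , h) = p , hp , ⟨⟩∈-mono r⊆s h

  SubstStep-mono : r ⊆ s → SubstStep M r t x y → SubstStep M s t x y
  SubstStep-mono sub (inj₁ h) = inj₁ h
  SubstStep-mono sub (inj₂ (inj₁ (ψ , ψ′ , h , h′ , h₁))) =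
    inj₂ (inj₁ (ψ , ψ′ , h , h′ , ⟨∣∣⟩∈-mono sub h₁))
  SubstStep-mono sub (inj₂ (inj₂ (inj₁ (ψ₁ , ψ₂ , ψ₁′ , ψ₂′ , h , h′ , h₁ , h₂)))) =
    inj₂ (inj₂ (inj₁ (ψ₁ , ψ₂ , ψ₁′ , ψ₂′ , h , h′ , ⟨∣∣⟩∈-mono sub h₁ , ⟨∣∣⟩∈-mono sub h₂)))
  SubstStep-mono sub (inj₂ (inj₂ (inj₂ (i , ψ , ψ′ , s′ , h , h′ , hw , h₁)))) =
    inj₂ (inj₂ (inj₂ (i , ψ , ψ′ , s′ , h , h′ , hw , ⟨∣∣⟩∈-mono sub h₁)))

  private
    -- Substitution is a ternary recursion, with its last two arguments paired.
    SubstStep₂ : V → V → V → Set ℓ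
    SubstStep₂ r s p = ∀ φ χ → p ≡ ⟪ φ , χ ⟫ → SubstStep M r s φ χ

    SubstStep₂-mono : r ⊆ s → SubstStep₂ r x y → SubstStep₂ s x y
    SubstStep₂-mono sub step φ χ e = SubstStep-mono sub (step φ χ e)

    module DepthRec = Recursion (DepthStep M) DepthStep-mono
    module FreeVarsRec = Recursion (FreeVarsStep M) FreeVarsStep-mono
    module SubstRec = Recursion SubstStep₂ SubstStep₂-mono

    ⟨∣∣⟩∈⇔ : ⟨_∣_∣_⟩∈_ M s x y r ⇔ ⟪ s , ⟪ x , y ⟫ ⟫ ∈ r
    ⟨∣∣⟩∈⇔ = mk⇔ (λ (p , hp , h) → subst (λ p → ⟪ _ , p ⟫ ∈ _) (IsPair⇒≡ hp) (to ⟨⟩∈⇔ h))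
                  (λ h → _ , ⟪⟫-isPair , from ⟨⟩∈⇔ h)

    IsSubst⇔Rec : IsSubst M s φ χ ⇔ SubstRec.Rec s ⟪ φ , χ ⟫
    IsSubst⇔Rec = mk⇔
      (λ (r , h , closed) → r , from ⟨⟩∈⇔ (to ⟨∣∣⟩∈⇔ h) , λ where
        s _ h φ χ refl → closed s φ χ (from ⟨∣∣⟩∈⇔ (to ⟨⟩∈⇔ h)))
      (λ (r , h , closed) → r , from ⟨∣∣⟩∈⇔ (to ⟨⟩∈⇔ h) , λ s φ χ h →
        closed s _ (from ⟨⟩∈⇔ (to ⟨∣∣⟩∈⇔ h)) φ χ refl)

    step₂ : SubstStep M r s φ χ → SubstStep₂ r s ⟪ φ , χ ⟫
    step₂ h φ χ e with refl , refl ← ⟪⟫-injective e = h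

  -- One step of the recursion, indexed by the head, with each membership in the witnessing set
  -- already turned into a new instance of the recursion. Once the head is known, a match on the
  -- view leaves one case. `FreeVarsView` and `SubstView` have the same purpose.
  data DepthView : Head → V → Set ℓ where
    eq  : IsVar M t i → IsVar M u k → IsEmpty M d → DepthView (eq t u) d
    mem : IsVar M t i → IsVar M u k → IsEmpty M d → DepthView (mem t u) d
    neg : HasDepth M ψ a → IsSuc M d a → DepthView (neg ψ) d
    or  : HasDepth M ψ a → HasDepth M χ b → IsMax M c a b → IsSuc M d c → DepthView (or ψ χ) d
    ex  : HasDepth M ψ a → IsSuc M d a → DepthView (ex i ψ) d

  -- The depths of the parts are elements of `d`, and elements of a finite ordinal are finite
  -- ordinals; this restores the first component of `HasDepth` for the parts.
  depth-view : HasDepth M φ d → ∃[ h ] IsHead φ h × DepthView h d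
  depth-view {φ} {d} (ωd , rec) with DepthRec.unfold rec
  ... | r , inj₁ ((t , u , i , k , ht , hu , inj₁ h) , hd) , _ = eq t u , h , eq ht hu hd
  ... | r , inj₁ ((t , u , i , k , ht , hu , inj₂ h) , hd) , _ = mem t u , h , mem ht hu hd
  ... | r , inj₂ (inj₁ (ψ , e , h , h₁ , hs)) , sub =
    neg ψ , h , neg (∈-isFiniteOrdinal ωd (IsSuc⇒∈ hs) , sub h₁) hs
  ... | r , inj₂ (inj₂ (inj₁ (ψ₁ , ψ₂ , e₁ , e₂ , m , h , h₁ , h₂ , hm , hs))) , sub =
    or ψ₁ ψ₂ , h ,
    or (∈-isFiniteOrdinal ωd (≤ᵒ-∈-trans ωd (proj₁ (proj₂ hm)) (IsSuc⇒∈ hs)) , sub h₁)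
       (∈-isFiniteOrdinal ωd (≤ᵒ-∈-trans ωd (proj₂ (proj₂ hm)) (IsSuc⇒∈ hs)) , sub h₂) hm hs
  ... | r , inj₂ (inj₂ (inj₂ (i , ψ , e , h , h₁ , hs))) , sub =
    ex i ψ , h , ex (∈-isFiniteOrdinal ωd (IsSuc⇒∈ hs) , sub h₁) hs

  depth-fold : IsFiniteOrdinal M d → IsHead φ h → DepthView h d → HasDepth M φ d
  depth-fold ωd hφ (eq ht hu hd)  = ωd , DepthRec.fold₀ (inj₁ ((_ , _ , _ , _ , ht , hu , inj₁ hφ) , hd))
  depth-fold ωd hφ (mem ht hu hd) = ωd , DepthRec.fold₀ (inj₁ ((_ , _ , _ , _ , ht , hu , inj₂ hφ) , hd))
  depth-fold ωd hφ (neg (_ , rec) hs) = ωd , DepthRec.fold₁ rec λ h →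
    inj₂ (inj₁ (_ , _ , hφ , from ⟨⟩∈⇔ h , hs))
  depth-fold ωd hφ (or (_ , rec₁) (_ , rec₂) hm hs) = ωd , DepthRec.fold₂ rec₁ rec₂ λ h₁ h₂ →
    inj₂ (inj₂ (inj₁ (_ , _ , _ , _ , _ , hφ , from ⟨⟩∈⇔ h₁ , from ⟨⟩∈⇔ h₂ , hm , hs)))
  depth-fold ωd hφ (ex (_ , rec) hs) = ωd , DepthRec.fold₁ rec λ h →
    inj₂ (inj₂ (inj₂ (_ , _ , _ , hφ , from ⟨⟩∈⇔ h , hs)))

  data FreeVarsView : Head → V → Set ℓ where
    eq  : (∀ k → k ∈ f ⇔ (IsVar M t k ⊎ IsVar M u k)) → FreeVarsView (eq t u) f
    mem : (∀ k → k ∈ f ⇔ (IsVar M t k ⊎ IsVar M u k)) → FreeVarsView (mem t u) f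
    neg : HasFreeVars M ψ f → FreeVarsView (neg ψ) f
    or  : HasFreeVars M ψ a → HasFreeVars M χ b → (∀ k → k ∈ f ⇔ (k ∈ a ⊎ k ∈ b)) →
          FreeVarsView (or ψ χ) f
    ex  : HasFreeVars M ψ a → (∀ k → k ∈ f ⇔ (k ∈ a × k ≢ i)) → FreeVarsView (ex i ψ) f

  freeVars-view : HasFreeVars M φ f → ∃[ h ] IsHead φ h × FreeVarsView h f
  freeVars-view rec with FreeVarsRec.unfold rec
  ... | r , inj₁ (t , u , inj₁ h , hf) , _ = eq t u , h , eq hf
  ... | r , inj₁ (t , u , inj₂ h , hf) , _ = mem t u , h , mem hf
  ... | r , inj₂ (inj₁ (ψ , h , h₁)) , sub = neg ψ , h , neg (sub h₁)
  ... | r , inj₂ (inj₂ (inj₁ (ψ₁ , ψ₂ , f₁ , f₂ , h , h₁ , h₂ , hf))) , sub =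
    or ψ₁ ψ₂ , h , or (sub h₁) (sub h₂) hf
  ... | r , inj₂ (inj₂ (inj₂ (i , ψ , g , h , h₁ , hf))) , sub = ex i ψ , h , ex (sub h₁) hf

  freeVars-fold : IsHead φ h → FreeVarsView h f → HasFreeVars M φ f
  freeVars-fold hφ (eq hf)  = FreeVarsRec.fold₀ (inj₁ (_ , _ , inj₁ hφ , hf))
  freeVars-fold hφ (mem hf) = FreeVarsRec.fold₀ (inj₁ (_ , _ , inj₂ hφ , hf))
  freeVars-fold hφ (neg rec) = FreeVarsRec.fold₁ rec λ h → inj₂ (inj₁ (_ , hφ , from ⟨⟩∈⇔ h))
  freeVars-fold hφ (or rec₁ rec₂ hf) = FreeVarsRec.fold₂ rec₁ rec₂ λ h₁ h₂ →
    inj₂ (inj₂ (inj₁ (_ , _ , _ , _ , hφ , from ⟨⟩∈⇔ h₁ , from ⟨⟩∈⇔ h₂ , hf)))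
  freeVars-fold hφ (ex rec hf) = FreeVarsRec.fold₁ rec λ h →
    inj₂ (inj₂ (inj₂ (_ , _ , _ , hφ , from ⟨⟩∈⇔ h , hf)))

  data SubstView (s : V) : Head → Head → Set ℓ where
    eq  : IsTermSubst M s t t′ → IsTermSubst M s u x → SubstView s (eq t u) (eq t′ x)
    mem : IsTermSubst M s t t′ → IsTermSubst M s u x → SubstView s (mem t u) (mem t′ x)
    neg : IsSubst M s ψ x → SubstView s (neg ψ) (neg x)
    or  : IsSubst M s ψ x → IsSubst M s χ y → SubstView s (or ψ χ) (or x y)
    ex  : IsWithout M t s i → IsSubst M t ψ x → SubstView s (ex i ψ) (ex i x)

  subst-view : IsSubst M s φ χ → ∃₂ λ h h′ → IsHead φ h × IsHead χ h′ × SubstView s h h′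
  subst-view rec with r , step , sub ← SubstRec.unfold (to IsSubst⇔Rec rec) with step _ _ refl
  ... | inj₁ (t , u , t′ , u′ , ht , hu , inj₁ (h , h′)) = eq t u , eq t′ u′ , h , h′ , eq ht hu
  ... | inj₁ (t , u , t′ , u′ , ht , hu , inj₂ (h , h′)) = mem t u , mem t′ u′ , h , h′ , mem ht hu
  ... | inj₂ (inj₁ (ψ , ψ′ , h , h′ , h₁)) =
    neg ψ , neg ψ′ , h , h′ , neg (from IsSubst⇔Rec (sub (from ⟨⟩∈⇔ (to ⟨∣∣⟩∈⇔ h₁))))
  ... | inj₂ (inj₂ (inj₁ (ψ₁ , ψ₂ , ψ₁′ , ψ₂′ , h , h′ , h₁ , h₂))) =
    or ψ₁ ψ₂ , or ψ₁′ ψ₂′ , h , h′ ,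
    or (from IsSubst⇔Rec (sub (from ⟨⟩∈⇔ (to ⟨∣∣⟩∈⇔ h₁))))
       (from IsSubst⇔Rec (sub (from ⟨⟩∈⇔ (to ⟨∣∣⟩∈⇔ h₂))))
  ... | inj₂ (inj₂ (inj₂ (i , ψ , ψ′ , s′ , h , h′ , hw , h₁))) =
    ex i ψ , ex i ψ′ , h , h′ , ex hw (from IsSubst⇔Rec (sub (from ⟨⟩∈⇔ (to ⟨∣∣⟩∈⇔ h₁))))

  subst-fold : IsHead φ h → IsHead χ h′ → SubstView s h h′ → IsSubst M s φ χ
  subst-fold hφ hχ (eq ht hu) = from IsSubst⇔Rec
    (SubstRec.fold₀ (step₂ (inj₁ (_ , _ , _ , _ , ht , hu , inj₁ (hφ , hχ)))))
  subst-fold hφ hχ (mem ht hu) = from IsSubst⇔Rec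
    (SubstRec.fold₀ (step₂ (inj₁ (_ , _ , _ , _ , ht , hu , inj₂ (hφ , hχ)))))
  subst-fold hφ hχ (neg h₁) = from IsSubst⇔Rec (SubstRec.fold₁ (to IsSubst⇔Rec h₁) λ h →
    step₂ (inj₂ (inj₁ (_ , _ , hφ , hχ , from ⟨∣∣⟩∈⇔ h))))
  subst-fold hφ hχ (or h₁ h₂) = from IsSubst⇔Rec
    (SubstRec.fold₂ (to IsSubst⇔Rec h₁) (to IsSubst⇔Rec h₂) λ h h′ →
      step₂ (inj₂ (inj₂ (inj₁ (_ , _ , _ , _ , hφ , hχ , from ⟨∣∣⟩∈⇔ h , from ⟨∣∣⟩∈⇔ h′)))))
  subst-fold hφ hχ (ex hw h₁) = from IsSubst⇔Rec (SubstRec.fold₁ (to IsSubst⇔Rec h₁) λ h →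
    step₂ (inj₂ (inj₂ (inj₂ (_ , _ , _ , _ , hφ , hχ , hw , from ⟨∣∣⟩∈⇔ h)))))

  depth-view-at : IsHead φ h → HasDepth M φ d → DepthView h d
  depth-view-at hφ hd with h′ , hφ′ , v ← depth-view hd with refl ← head-unique hφ hφ′ = v

  freeVars-view-at : IsHead φ h → HasFreeVars M φ f → FreeVarsView h f
  freeVars-view-at hφ hf with h′ , hφ′ , v ← freeVars-view hf with refl ← head-unique hφ hφ′ = v

  subst-view-from : IsHead φ h → IsSubst M s φ χ → ∃[ h′ ] IsHead χ h′ × SubstView s h h′
  subst-view-from hφ hs with h , h′ , hφ′ , hχ , v ← subst-view hs
    with refl ← head-unique hφ hφ′ = h′ , hχ , v

  subst-view-to : IsHead χ h′ → IsSubst M s φ χ → ∃[ h ] IsHead φ h × SubstView s h h′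
  subst-view-to hχ hs with h , h′ , hφ , hχ′ , v ← subst-view hs
    with refl ← head-unique hχ hχ′ = h , hφ , v

-- Substitution and truth for codes of standard depth.

module Truth {ℓ ℓ′ : Level} (em : ExcludedMiddle ℓ) (M : SetStructure ℓ)
             (𝔛 : Classes M ℓ′) (gb : GBCore M 𝔛) where
  open SetStructure M
  open Definability em M
  open SetTheory em M 𝔛 gb
  open Syntax em M 𝔛 gb

  private variable
    a b d f i k p r s s′ t t′ u u′ x x′ y y′ z φ χ ψ : V
    m n : ℕ
    h h′ : Head

  IsTerm : V → Set ℓ
  IsTerm t = ∃ (IsVar M t) ⊎ ∃ (IsConst M t)

  mutual
    -- Codes of formulas, possibly with constants, of standard depth at most n.
    data Depth≤ (n : ℕ) (φ : V) : Set ℓ where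
      at : IsHead φ h → HeadDepth≤ n h → Depth≤ n φ

    -- The index is what decreases when truth is followed through a quantifier: an instance of the
    -- body has a derivation unrelated in size to that of the body, but it obeys the same smaller
    -- bound.
    data HeadDepth≤ : ℕ → Head → Set ℓ where
      eq  : IsTerm t → IsTerm u → HeadDepth≤ n (eq t u)
      mem : IsTerm t → IsTerm u → HeadDepth≤ n (mem t u)
      neg : Depth≤ n ψ → HeadDepth≤ (suc n) (neg ψ)
      or  : Depth≤ n ψ → Depth≤ n χ → HeadDepth≤ (suc n) (or ψ χ)
      ex  : Depth≤ n ψ → HeadDepth≤ (suc n) (ex i ψ)

  depth≤-at : IsHead φ h → Depth≤ n φ → HeadDepth≤ n h
  depth≤-at hφ (at hφ′ D) with refl ← head-unique hφ hφ′ = D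

  -- Here an internal depth becomes an external one. The depth of a compound formula is a successor,
  -- which excludes `n` = 0 and otherwise puts the depths of the parts below the predecessor of `n`.
  HasDepth⇒Depth≤ : ∀ n → HasDepth M φ d → _≤ᵒ_ M d (num n) → Depth≤ n φ
  HasDepth⇒Depth≤ n hd d≤n with depth-view hd
  ... | eq _ _ , hφ , eq ht hu _ = at hφ (eq (inj₁ (_ , ht)) (inj₁ (_ , hu)))
  ... | mem _ _ , hφ , mem ht hu _ = at hφ (mem (inj₁ (_ , ht)) (inj₁ (_ , hu)))
  HasDepth⇒Depth≤ zero hd d≤0 | neg _ , _ , neg _ hs =
    ⊥-elim (∉∅ (∈-≤ᵒ-trans (num-isFiniteOrdinal 0) (IsSuc⇒∈ hs) d≤0))
  HasDepth⇒Depth≤ zero hd d≤0 | or _ _ , _ , or _ _ _ hs =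
    ⊥-elim (∉∅ (∈-≤ᵒ-trans (num-isFiniteOrdinal 0) (IsSuc⇒∈ hs) d≤0))
  HasDepth⇒Depth≤ zero hd d≤0 | ex _ _ , _ , ex _ hs =
    ⊥-elim (∉∅ (∈-≤ᵒ-trans (num-isFiniteOrdinal 0) (IsSuc⇒∈ hs) d≤0))
  HasDepth⇒Depth≤ (suc n) hd d≤n | neg _ , hφ , neg hψ hs =
    at hφ (neg (HasDepth⇒Depth≤ n hψ (∈-suc*⇒≤ᵒ
      (∈-≤ᵒ-trans (num-isFiniteOrdinal (suc n)) (IsSuc⇒∈ hs) d≤n))))
  HasDepth⇒Depth≤ (suc n) hd d≤n | or _ _ , hφ , or hψ hχ (_ , a≤c , b≤c) hs =
    at hφ (or (HasDepth⇒Depth≤ n hψ (∈-suc*⇒≤ᵒ (≤ᵒ-∈-trans (num-isFiniteOrdinal (suc n)) a≤c c∈)))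
              (HasDepth⇒Depth≤ n hχ (∈-suc*⇒≤ᵒ (≤ᵒ-∈-trans (num-isFiniteOrdinal (suc n)) b≤c c∈))))
    where c∈ = ∈-≤ᵒ-trans (num-isFiniteOrdinal (suc n)) (IsSuc⇒∈ hs) d≤n
  HasDepth⇒Depth≤ (suc n) hd d≤n | ex _ _ , hφ , ex hψ hs =
    at hφ (ex (HasDepth⇒Depth≤ n hψ (∈-suc*⇒≤ᵒ
      (∈-≤ᵒ-trans (num-isFiniteOrdinal (suc n)) (IsSuc⇒∈ hs) d≤n))))

  termSubst-source : IsTermSubst M s t t′ → IsTerm t
  termSubst-source (inj₁ (i , _ , ht , _))   = inj₁ (i , ht)
  termSubst-source (inj₂ (inj₁ (i , ht , _))) = inj₁ (i , ht)
  termSubst-source (inj₂ (inj₂ (a , ht , _))) = inj₂ (a , ht)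

  termSubst-target : IsTermSubst M s t t′ → IsTerm t′
  termSubst-target (inj₁ (_ , a , _ , _ , ht′))     = inj₂ (a , ht′)
  termSubst-target (inj₂ (inj₁ (i , ht , _ , refl))) = inj₁ (i , ht)
  termSubst-target (inj₂ (inj₂ (a , ht , refl)))     = inj₂ (a , ht)

  termSubst-total : ∀ s → IsTerm t → ∃ (IsTermSubst M s t)
  termSubst-total s (inj₂ (a , ht)) = _ , inj₂ (inj₂ (a , ht , refl))
  termSubst-total s (inj₁ (i , ht)) with em {P = ∃[ a ] ⟨_,_⟩∈_ M i a s}
  ... | yes (a , h) = _ , inj₁ (i , a , ht , h , tagged 1)
  ... | no ¬h       = _ , inj₂ (inj₁ (i , ht , (λ a h → ¬h (a , h)) , refl))

  mutual
    subst-Depth≤ : Depth≤ n φ → IsSubst M s φ χ → Depth≤ n χ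
    subst-Depth≤ (at hφ D) hs =
      case subst-view-from hφ hs of λ (_ , hχ , v) → at hχ (substHead-Depth≤ D v)

    substHead-Depth≤ : HeadDepth≤ n h → SubstView s h h′ → HeadDepth≤ n h′
    substHead-Depth≤ (eq _ _)   (eq ht hu)  = eq (termSubst-target ht) (termSubst-target hu)
    substHead-Depth≤ (mem _ _)  (mem ht hu) = mem (termSubst-target ht) (termSubst-target hu)
    substHead-Depth≤ (neg D)    (neg hs)    = neg (subst-Depth≤ D hs)
    substHead-Depth≤ (or D₁ D₂) (or hs₁ hs₂) = or (subst-Depth≤ D₁ hs₁) (subst-Depth≤ D₂ hs₂)
    substHead-Depth≤ (ex D)     (ex _ hs)   = ex (subst-Depth≤ D hs)

  mutual
    -- The formula underlying a sentence of a truth class is known only to have depth at most a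
    -- possibly nonstandard `p`; its standard bound has to be recovered from the sentence.
    subst-Depth≤⁻ : Depth≤ n χ → IsSubst M s φ χ → Depth≤ n φ
    subst-Depth≤⁻ (at hχ D) hs =
      case subst-view-to hχ hs of λ (_ , hφ , v) → at hφ (substHead-Depth≤⁻ D v)

    substHead-Depth≤⁻ : HeadDepth≤ n h′ → SubstView s h h′ → HeadDepth≤ n h
    substHead-Depth≤⁻ (eq _ _)   (eq ht hu)  = eq (termSubst-source ht) (termSubst-source hu)
    substHead-Depth≤⁻ (mem _ _)  (mem ht hu) = mem (termSubst-source ht) (termSubst-source hu)
    substHead-Depth≤⁻ (neg D)    (neg hs)    = neg (subst-Depth≤⁻ D hs)
    substHead-Depth≤⁻ (or D₁ D₂) (or hs₁ hs₂) = or (subst-Depth≤⁻ D₁ hs₁) (subst-Depth≤⁻ D₂ hs₂)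
    substHead-Depth≤⁻ (ex D)     (ex _ hs)   = ex (subst-Depth≤⁻ D hs)

  mutual
    subst-total : Depth≤ n φ → ∀ s → ∃ (IsSubst M s φ)
    subst-total (at hφ D) s =
      case substHead-total hφ D s of λ (_ , hχ , v) → _ , subst-fold hφ hχ v

    substHead-total : IsHead φ h → HeadDepth≤ n h → ∀ s →
                      ∃[ h′ ] IsHead (code h′) h′ × SubstView s h h′
    substHead-total _ (eq ht hu) s =
      _ , tagged-pair 0 , eq (proj₂ (termSubst-total s ht)) (proj₂ (termSubst-total s hu))
    substHead-total _ (mem ht hu) s =
      _ , tagged-pair 1 , mem (proj₂ (termSubst-total s ht)) (proj₂ (termSubst-total s hu))
    substHead-total _ (neg D) s = _ , tagged 2 , neg (proj₂ (subst-total D s))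
    substHead-total _ (or D₁ D₂) s =
      _ , tagged-pair 3 , or (proj₂ (subst-total D₁ s)) (proj₂ (subst-total D₂ s))
    substHead-total (ωi , _) (ex {i = i} D) s =
      _ , (ωi , tagged-pair 4) , ex (proj₂ (without s i)) (proj₂ (subst-total D _))

  -- `u` acts as `s` followed by `t`. A variable in the domain of `s` has become a constant before
  -- `t` is applied, so `t` matters only outside that domain.
  IsComposite : V → V → V → Set ℓ
  IsComposite s t u = ∀ i a →
    ⟪ i , a ⟫ ∈ u ⇔ (⟪ i , a ⟫ ∈ s ⊎ (⟪ i , a ⟫ ∈ t × (∀ b → ¬ ⟪ i , b ⟫ ∈ s)))

  composite-without : IsComposite s t u → IsWithout M s′ s i → IsWithout M t′ t i →
                      IsWithout M u′ u i → IsComposite s′ t′ u′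
  composite-without comp ws wt wu j a = mk⇔
    (λ h → let h , j≢i = to (∈-without wu) h in
      ⊎-map (λ h → from (∈-without ws) (h , j≢i))
            (λ (h , fresh) → from (∈-without wt) (h , j≢i) ,
                             λ b h → fresh b (proj₁ (to (∈-without ws) h)))
            (to (comp j a) h))
    [ (λ h → let h , j≢i = to (∈-without ws) h in
         from (∈-without wu) (from (comp j a) (inj₁ h) , j≢i))
    , (λ (h , fresh) → let h , j≢i = to (∈-without wt) h in
         from (∈-without wu)
           (from (comp j a) (inj₂ (h , λ b h → fresh b (from (∈-without ws) (h , j≢i)))) , j≢i))
    ]′

  termSubst-compose : IsComposite s t u → IsTermSubst M s x y → IsTermSubst M t y z →
                      IsTermSubst M u x z
  termSubst-compose comp (inj₁ (i , a , hx , h , hy)) (inj₁ (_ , _ , hy′ , _)) =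
    contradiction hy (¬IsVar×IsConst hy′)
  termSubst-compose comp (inj₁ (i , a , hx , h , hy)) (inj₂ (inj₁ (_ , hy′ , _))) =
    contradiction hy (¬IsVar×IsConst hy′)
  termSubst-compose comp (inj₁ (i , a , hx , h , hy)) (inj₂ (inj₂ (_ , _ , refl))) =
    inj₁ (i , a , hx , from ⟨⟩∈⇔ (from (comp i a) (inj₁ (to ⟨⟩∈⇔ h))) , hy)
  termSubst-compose comp (inj₂ (inj₁ (i , hx , fresh , refl))) (inj₁ (j , b , hx′ , h , hz))
    with refl ← IsVar-unique hx hx′ =
    inj₁ (i , b , hx , from ⟨⟩∈⇔ (from (comp i b)
      (inj₂ (to ⟨⟩∈⇔ h , λ c → fresh c ∘ from ⟨⟩∈⇔))) , hz)
  termSubst-compose comp (inj₂ (inj₁ (i , hx , fresh , refl))) (inj₂ (inj₁ (j , hx′ , fresh′ , refl)))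
    with refl ← IsVar-unique hx hx′ =
    inj₂ (inj₁ (i , hx , (λ a → [ fresh a ∘ from ⟨⟩∈⇔ , fresh′ a ∘ from ⟨⟩∈⇔ ∘ proj₁ ]′
                                 ∘ to (comp i a) ∘ to ⟨⟩∈⇔) , refl))
  termSubst-compose comp (inj₂ (inj₁ (i , hx , _ , refl))) (inj₂ (inj₂ (_ , hx′ , _))) =
    contradiction hx′ (¬IsVar×IsConst hx)
  termSubst-compose comp (inj₂ (inj₂ (a , hx , refl))) (inj₁ (_ , _ , hx′ , _)) =
    contradiction hx (¬IsVar×IsConst hx′)
  termSubst-compose comp (inj₂ (inj₂ (a , hx , refl))) (inj₂ (inj₁ (_ , hx′ , _))) =
    contradiction hx (¬IsVar×IsConst hx′)
  termSubst-compose comp (inj₂ (inj₂ (a , hx , refl))) (inj₂ (inj₂ (_ , _ , refl))) =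
    inj₂ (inj₂ (a , hx , refl))

  mutual
    -- At a quantifier the bound variable is removed from all three substitutions, which preserves
    -- `IsComposite`. Capture cannot occur, since only constants are substituted.
    subst-compose : Depth≤ n φ → IsComposite s t u → IsSubst M s φ ψ → IsSubst M t ψ χ →
                    IsSubst M u φ χ
    subst-compose (at hφ D) comp hs ht =
      case subst-view-from hφ hs of λ (_ , hψ , v) →
      case subst-view-from hψ ht of λ (_ , hχ , w) →
      subst-fold hφ hχ (substHead-compose D comp v w)

    substHead-compose : ∀ {h″} → HeadDepth≤ n h → IsComposite s t u →
                        SubstView s h h′ → SubstView t h′ h″ → SubstView u h h″
    substHead-compose (eq _ _) comp (eq ht hu) (eq ht′ hu′) =
      eq (termSubst-compose comp ht ht′) (termSubst-compose comp hu hu′)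
    substHead-compose (mem _ _) comp (mem ht hu) (mem ht′ hu′) =
      mem (termSubst-compose comp ht ht′) (termSubst-compose comp hu hu′)
    substHead-compose (neg D) comp (neg hs) (neg ht) = neg (subst-compose D comp hs ht)
    substHead-compose (or D₁ D₂) comp (or hs₁ hs₂) (or ht₁ ht₂) =
      or (subst-compose D₁ comp hs₁ ht₁) (subst-compose D₂ comp hs₂ ht₂)
    substHead-compose {u = u} (ex {i = i} D) comp (ex ws hs) (ex wt ht) =
      case without u i of λ (_ , wu) → ex wu (subst-compose D (composite-without comp ws wt wu) hs ht)

  instance-Depth≤ : Depth≤ n ψ → IsInstance M i a ψ χ → Depth≤ n χ
  instance-Depth≤ D (_ , _ , _ , _ , hs) = subst-Depth≤ D hs

  instance-total : Depth≤ n ψ → ∀ i a → ∃ (IsInstance M i a ψ)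
  instance-total D i a =
    case subst-total D ⟅ ⟪ i , a ⟫ ⟆₁ of λ (χ , hs) → χ , _ , _ , ⟪⟫-isPair , (λ z → ∈-⟅⟆) , hs

  -- This rewrites an instance of the body of a quantified sentence as a single substitution into
  -- the body of the underlying formula, the form that `IsSentenceOfDepth` requires.
  instance-compose : Depth≤ n φ → IsWithout M s′ s i → IsUpdate u s i a → IsSubst M s′ φ ψ →
                     IsInstance M i a ψ χ → IsSubst M u φ χ
  instance-compose {s′ = s′} {i = i} {u = u} {a = a} D ws up hs (_ , _ , hp , ht , ht′) =
    subst-compose D comp hs
      (subst (λ t → IsSubst M t _ _) (trans (IsUPair⇒≡ ht) (cong ⟅_⟆₁ (IsPair⇒≡ hp))) ht′)
    where
    comp : IsComposite s′ ⟅ ⟪ i , a ⟫ ⟆₁ u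
    comp j b = ∈-update up ⨾ mk⇔
      [ (λ h → inj₁ (from (∈-without ws) h))
      , (λ where (refl , refl) → inj₂ (x∈⟅x,y⟆ , λ c h → proj₂ (to (∈-without ws) h) refl)) ]′
      [ (λ h → inj₁ (to (∈-without ws) h))
      , (λ (h , _) → inj₂ (⟪⟫-injective (∈-⟅⟆₁ h))) ]′

  ×-cong-⇔ : ∀ {A B C : Set ℓ} → (A → B ⇔ C) → (A × B) ⇔ (A × C)
  ×-cong-⇔ e = mk⇔ (λ (x , y) → x , to (e x) y) (λ (x , y) → x , from (e x) y)

  mutual
    -- Tarskian truth of codes of depth at most n; false on atomic formulas
    -- with a variable and on codes of depth greater than n.
    True : ℕ → V → Set ℓ
    True n χ = ∃[ h ] IsHead χ h × HeadTrue h n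

    HeadTrue : Head → ℕ → Set ℓ
    HeadTrue (eq t u)  _       = ∃[ a ] ∃[ b ] IsConst M t a × IsConst M u b × a ≡ b
    HeadTrue (mem t u) _       = ∃[ a ] ∃[ b ] IsConst M t a × IsConst M u b × a ∈ b
    HeadTrue _         zero    = Lift ℓ ⊥
    HeadTrue (neg ψ)   (suc n) = ¬ True n ψ
    HeadTrue (or ψ χ)  (suc n) = True n ψ ⊎ True n χ
    HeadTrue (ex i ψ)  (suc n) = ∃[ x ] ∃[ ψ′ ] IsInstance M i x ψ ψ′ × True n ψ′

  true-at : IsHead χ h → True n χ ⇔ HeadTrue h n
  true-at {n = n} hχ = mk⇔
    (λ (h , hχ′ , tr) → subst (λ h → HeadTrue h n) (head-unique hχ′ hχ) tr) (λ tr → _ , hχ , tr)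

  eq-true : ∀ n → IsConst M t a → IsConst M u b → HeadTrue (eq t u) n ⇔ a ≡ b
  eq-true _ ht hu = mk⇔
    (λ (_ , _ , ht′ , hu′ , e) → trans (IsConst-unique ht ht′) (trans e (IsConst-unique hu′ hu)))
    (λ e → _ , _ , ht , hu , e)

  mem-true : ∀ n → IsConst M t a → IsConst M u b → HeadTrue (mem t u) n ⇔ a ∈ b
  mem-true _ ht hu = mk⇔
    (λ (_ , _ , ht′ , hu′ , e) →
      subst (_∈ _) (IsConst-unique ht′ ht) (subst (_ ∈_) (IsConst-unique hu′ hu) e))
    (λ e → _ , _ , ht , hu , e)

  mutual
    -- The clauses of `True (suc n)` refer to `True n` on the parts, whereas a truth class refers to
    -- itself. The two agree because the index has no effect once it bounds the depth.
    true-suc : Depth≤ n χ → True n χ ⇔ True (suc n) χ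
    true-suc (at hχ D) = true-at hχ ⨾ headTrue-suc D ⨾ ⇔.sym (true-at hχ)

    headTrue-suc : HeadDepth≤ n h → HeadTrue h n ⇔ HeadTrue h (suc n)
    headTrue-suc (eq _ _)   = ⇔.refl
    headTrue-suc (mem _ _)  = ⇔.refl
    headTrue-suc (neg D)    = ¬-cong-⇔ (true-suc D)
    headTrue-suc (or D₁ D₂) = true-suc D₁ ⊎-⇔ true-suc D₂
    headTrue-suc (ex D)     = ∃-cong-⇔ λ x → ∃-cong-⇔ λ ψ′ → ×-cong-⇔ λ hi →
      true-suc (instance-Depth≤ D hi)

  private
    atomicᵈ : ∀ {k} (i : Fin k) → Definable (λ v → let χ = lookup v i in
      (∃[ t ] ∃[ u ] IsEq M χ t u × (∃[ a ] ∃[ b ] IsConst M t a × IsConst M u b × a ≡ b)) ⊎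
      (∃[ t ] ∃[ u ] IsMem M χ t u × (∃[ a ] ∃[ b ] IsConst M t a × IsConst M u b × a ∈ b)))
    atomicᵈ i =
      ∃ᵈ (∃ᵈ (IsEqᵈ (2 ↑ʳ i) v₁ v₀ ×ᵈ ∃ᵈ (∃ᵈ (IsConstᵈ v₃ v₁ ×ᵈ IsConstᵈ v₂ v₀ ×ᵈ v₁ ≡ᵈ v₀)))) ⊎ᵈ
      ∃ᵈ (∃ᵈ (IsMemᵈ (2 ↑ʳ i) v₁ v₀ ×ᵈ ∃ᵈ (∃ᵈ (IsConstᵈ v₃ v₁ ×ᵈ IsConstᵈ v₂ v₀ ×ᵈ v₁ ∈ᵈ v₀))))

  -- External recursion on `n` yields a separate formula for each `n`, which is why depths have to
  -- be standard. The existential over `Head` is not a quantifier over V, so it is split into the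
  -- kinds of head that can be true at the given index.
  Trueᵈ : ∀ n {k} (i : Fin k) → Definable (λ v → True n (lookup v i))
  Trueᵈ zero i = respᵈ
    (λ v → mk⇔
      [ (λ (t , u , h) → eq t u , h) , (λ (t , u , h) → mem t u , h) ]′
      (λ where
        (eq t u , h)  → inj₁ (t , u , h)
        (mem t u , h) → inj₂ (t , u , h)))
    (atomicᵈ i)
  Trueᵈ (suc n) i = respᵈ
    (λ v → mk⇔
      [ [ (λ (t , u , h) → eq t u , h) , (λ (t , u , h) → mem t u , h) ]′
      , [ (λ (ψ , h) → neg ψ , h)
        , [ (λ (ψ , χ , h) → or ψ χ , h) , (λ (i , ψ , h) → ex i ψ , h) ]′ ]′ ]′
      (λ where
        (eq t u , h)  → inj₁ (inj₁ (t , u , h))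
        (mem t u , h) → inj₁ (inj₂ (t , u , h))
        (neg ψ , h)   → inj₂ (inj₁ (ψ , h))
        (or ψ χ , h)  → inj₂ (inj₂ (inj₁ (ψ , χ , h)))
        (ex i ψ , h)  → inj₂ (inj₂ (inj₂ (i , ψ , h)))))
    (atomicᵈ i
      ⊎ᵈ ∃ᵈ (IsNegᵈ (1 ↑ʳ i) v₀ ×ᵈ ¬ᵈ Trueᵈ n v₀)
      ⊎ᵈ ∃ᵈ (∃ᵈ (IsOrᵈ (2 ↑ʳ i) v₁ v₀ ×ᵈ (Trueᵈ n v₁ ⊎ᵈ Trueᵈ n v₀)))
      ⊎ᵈ ∃ᵈ (∃ᵈ (IsExᵈ (2 ↑ʳ i) v₁ v₀ ×ᵈ
            ∃ᵈ (∃ᵈ (IsInstanceᵈ v₃ v₁ v₂ v₀ ×ᵈ Trueᵈ n v₀)))))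

  -- Sentences, truth classes and their agreement with `True n`.

  SentenceHead : V → Head → Set ℓ
  SentenceHead p (eq t u)  = ∃ (IsConst M t) × ∃ (IsConst M u)
  SentenceHead p (mem t u) = ∃ (IsConst M t) × ∃ (IsConst M u)
  SentenceHead p (neg ψ)   = IsDepthSentence M p ψ
  SentenceHead p (or ψ χ)  = IsDepthSentence M p ψ × IsDepthSentence M p χ
  SentenceHead p (ex i ψ)  = ∀ x ψ′ → IsInstance M i x ψ ψ′ → IsDepthSentence M p ψ′

  update-covers : (∀ k → k ∈ f → ∃[ a ] ⟨_,_⟩∈_ M k a s) → (∀ k → k ∈ f ⇔ (k ∈ d × k ≢ i)) →
                  IsUpdate u s i x → ∀ k → k ∈ d → ∃[ a ] ⟨_,_⟩∈_ M k a u
  update-covers {i = i} {x = x} cover free up k k∈d with em {P = k ≡ i}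
  ... | yes refl = x , from ⟨⟩∈⇔ (from (∈-update up) (inj₂ (refl , refl)))
  ... | no k≢i   = case cover k (from (free k) (k∈d , k≢i)) of λ (a , h) →
    a , from ⟨⟩∈⇔ (from (∈-update up) (inj₁ (to ⟨⟩∈⇔ h , k≢i)))

  -- The depth, free variables and substitution of the underlying formula are read one step down. At
  -- a quantifier the assignment is updated at the bound variable, so it still covers the free
  -- variables of the body.
  sentence-at : IsFiniteOrdinal M p → Depth≤ n χ → IsHead χ h → IsDepthSentence M p χ →
                SentenceHead p h
  sentence-at {p = p} {n = n} ωp D hχ (d , d≤p , φ , f , s , hd , hf , as , cover , hs) =
    case subst-view-to hχ hs of λ (_ , hφ , v) →
    go v (depth-view-at hφ hd) (freeVars-view-at hφ hf) (depth≤-at hχ D) hχ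
    where
    -- A variable left in place would lie outside the domain of `s`, but `s` covers all free
    -- variables.
    closedTerm : IsTermSubst M s t t′ → IsVar M t i → (∃[ a ] ⟨_,_⟩∈_ M i a s) → ∃ (IsConst M t′)
    closedTerm (inj₁ (_ , a , _ , _ , h)) _ _ = a , h
    closedTerm (inj₂ (inj₁ (_ , ht , fresh , _))) ht′ (a , h)
      with refl ← IsVar-unique ht ht′ = contradiction h (fresh a)
    closedTerm (inj₂ (inj₂ (a , ht , refl))) _ _ = a , ht

    go : ∀ {χ h h′} → SubstView s h h′ → DepthView h d → FreeVarsView h f → HeadDepth≤ n h′ →
         IsHead χ h′ → SentenceHead p h′
    go (eq ht hu) (eq vt vu _) (eq free) _ _ =
      closedTerm ht vt (cover _ (from (free _) (inj₁ vt))) ,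
      closedTerm hu vu (cover _ (from (free _) (inj₂ vu)))
    go (mem ht hu) (mem vt vu _) (mem free) _ _ =
      closedTerm ht vt (cover _ (from (free _) (inj₁ vt))) ,
      closedTerm hu vu (cover _ (from (free _) (inj₂ vu)))
    go (neg hs) (neg hd S) (neg hf) _ _ =
      _ , inj₁ (∈-≤ᵒ-trans ωp (IsSuc⇒∈ S) d≤p) , _ , _ , s , hd , hf , as , cover , hs
    go (or hs₁ hs₂) (or hd₁ hd₂ (_ , a≤c , b≤c) S) (or hf₁ hf₂ free) _ _ =
      (_ , inj₁ (≤ᵒ-∈-trans ωp a≤c c∈p) , _ , _ , s , hd₁ , hf₁ , as ,
        (λ i h → cover i (from (free i) (inj₁ h))) , hs₁) ,
      (_ , inj₁ (≤ᵒ-∈-trans ωp b≤c c∈p) , _ , _ , s , hd₂ , hf₂ , as ,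
        (λ i h → cover i (from (free i) (inj₂ h))) , hs₂)
      where c∈p = ∈-≤ᵒ-trans ωp (IsSuc⇒∈ S) d≤p
    go (ex {i = i} ws hs) (ex hd S) (ex {a = g} hf free) (ex D) (ωi , _) x ψ′ hi =
      case update s i x of λ (u , up) →
      _ , inj₁ (∈-≤ᵒ-trans ωp (IsSuc⇒∈ S) d≤p) , _ , _ , u , hd , hf ,
      update-isAssignment ωi as up , update-covers cover free up ,
      instance-compose (subst-Depth≤⁻ D hs) ws up hs hi

  module _ {T : Pred V ℓ} (ωp : IsFiniteOrdinal M p) (truth : IsDepthTruthClass M p T) where
    open IsDepthTruthClass truth
      renaming (eq to T-eq; mem to T-mem; neg to T-neg; or to T-or; ex to T-ex)

    -- The clauses for `T` apply only to sentences of depth at most `p`, so this property is handed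
    -- down to the parts together with the bound `n`.
    truthClass⇔True : Depth≤ n χ → IsDepthSentence M p χ → T χ ⇔ True n χ
    truthClass⇔True D@(at hχ E) S = go hχ S E (sentence-at ωp D hχ S) ⨾ ⇔.sym (true-at hχ)
      where
      go : IsHead χ h → IsDepthSentence M p χ → HeadDepth≤ n h → SentenceHead p h →
           T χ ⇔ HeadTrue h n
      go {n = n} hχ S (eq _ _) ((a , ht) , (b , hu)) =
        T-eq _ _ _ a b ht hu hχ S ⨾ ⇔.sym (eq-true n ht hu)
      go {n = n} hχ S (mem _ _) ((a , ht) , (b , hu)) =
        T-mem _ _ _ a b ht hu hχ S ⨾ ⇔.sym (mem-true n ht hu)
      go hχ S (neg D) Sψ = T-neg _ _ hχ S ⨾ ¬-cong-⇔ (truthClass⇔True D Sψ)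
      go hχ S (or D₁ D₂) (S₁ , S₂) =
        T-or _ _ _ hχ S ⨾ truthClass⇔True D₁ S₁ ⊎-⇔ truthClass⇔True D₂ S₂
      go hχ S (ex D) Sψ = T-ex _ _ _ hχ S ⨾ ∃-cong-⇔ λ x → ∃-cong-⇔ λ ψ′ → ×-cong-⇔ λ hi →
        truthClass⇔True (instance-Depth≤ D hi) (Sψ x ψ′ hi)

  TruthClass : ℕ → Pred V ℓ
  TruthClass n χ = IsDepthSentence M (num n) χ × True n χ

  depthSentence⇒Depth≤ : ∀ n → IsDepthSentence M (num n) χ → Depth≤ n χ
  depthSentence⇒Depth≤ n (_ , d≤n , _ , _ , _ , hd , _ , _ , _ , hs) =
    subst-Depth≤ (HasDepth⇒Depth≤ n hd d≤n) hs

  truthClass-isDepthTruthClass : ∀ n → IsDepthTruthClass M (num n) (TruthClass n)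
  truthClass-isDepthTruthClass n = record
    { sentences = λ χ → proj₁
    ; eq  = λ χ t u a b ht hu hχ S → T⇔ S ⨾ true-at {h = eq t u} hχ ⨾ eq-true n ht hu
    ; mem = λ χ t u a b ht hu hχ S → T⇔ S ⨾ true-at {h = mem t u} hχ ⨾ mem-true n ht hu
    ; neg = λ χ ψ hχ S → T⇔ S ⨾ true-at {h = neg ψ} hχ ⨾ neg′ (D hχ S) (sub (neg ψ) hχ S)
    ; or  = λ χ ψ₁ ψ₂ hχ S → T⇔ S ⨾ true-at {h = or ψ₁ ψ₂} hχ ⨾ or′ (D hχ S) (sub (or ψ₁ ψ₂) hχ S)
    ; ex  = λ χ i ψ hχ S → T⇔ S ⨾ true-at {h = ex i ψ} hχ ⨾ ex′ (D hχ S) (sub (ex i ψ) hχ S)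
    }
    where
    T⇔ : IsDepthSentence M (num n) χ → TruthClass n χ ⇔ True n χ
    T⇔ S = mk⇔ proj₂ (S ,_)

    D : IsHead χ h → IsDepthSentence M (num n) χ → HeadDepth≤ n h
    D hχ S = depth≤-at hχ (depthSentence⇒Depth≤ n S)

    sub : ∀ h → IsHead χ h → IsDepthSentence M (num n) χ → SentenceHead (num n) h
    sub _ hχ S = sentence-at (num-isFiniteOrdinal n) (depthSentence⇒Depth≤ n S) hχ S

    lower-true : ∀ {m} → Depth≤ m ψ → IsDepthSentence M (num (suc m)) ψ →
                 True m ψ ⇔ TruthClass (suc m) ψ
    lower-true D S = true-suc D ⨾ mk⇔ (S ,_) proj₂

    -- `n` is quantified afresh here so that the match on the depth bound can refine it to a
    -- successor.
    neg′ : ∀ {n} → HeadDepth≤ n (neg ψ) → SentenceHead (num n) (neg ψ) →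
           HeadTrue (neg ψ) n ⇔ (¬ TruthClass n ψ)
    neg′ (neg D) S = ¬-cong-⇔ (lower-true D S)

    or′ : ∀ {n} → HeadDepth≤ n (or ψ χ) → SentenceHead (num n) (or ψ χ) →
          HeadTrue (or ψ χ) n ⇔ (TruthClass n ψ ⊎ TruthClass n χ)
    or′ (or D₁ D₂) (S₁ , S₂) = lower-true D₁ S₁ ⊎-⇔ lower-true D₂ S₂

    ex′ : ∀ {n} → HeadDepth≤ n (ex i ψ) → SentenceHead (num n) (ex i ψ) →
          HeadTrue (ex i ψ) n ⇔ (∃[ x ] ∃[ ψ′ ] IsInstance M i x ψ ψ′ × TruthClass n ψ′)
    ex′ (ex D) S = ∃-cong-⇔ λ x → ∃-cong-⇔ λ ψ′ → ×-cong-⇔ λ hi →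
      lower-true (instance-Depth≤ D hi) (S x ψ′ hi)

  -- The bound `num n` is a set and not a term of the language; the formula instead describes it as
  -- the set satisfying `IsNumeral n`, which keeps the definition free of parameters.
  TruthClassᵈ : ∀ n → Definable {1} (λ v → TruthClass n (lookup v zero))
  TruthClassᵈ n = respᵈ
    (λ v → mk⇔ (λ (k , hk , S) → subst (λ k → IsDepthSentence M k _) (IsNumeral⇒≡ n hk) S)
               (λ S → num n , num-isNumeral n , S))
    (∃ᵈ (IsNumeralᵈ n v₀ ×ᵈ IsDepthSentenceᵈ v₀ v₁))
    ×ᵈ Trueᵈ n v₀

-- Codes of actual formulas and their truth.

module Coding {ℓ ℓ′ : Level} (em : ExcludedMiddle ℓ) (M : SetStructure ℓ)
              (𝔛 : Classes M ℓ′) (gb : GBCore M 𝔛) where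
  open SetStructure M
  open Definability em M
  open SetTheory em M 𝔛 gb
  open Syntax em M 𝔛 gb
  open Truth em M 𝔛 gb

  private variable
    a b d f k s t χ φ : V
    m n : ℕ

  -- `θ-Most` allows a single set parameter, so the first two parameters are replaced by their pair
  -- until one is left. It is placed before `x` so that its level is 1 and that of `x` is 0,
  -- matching `IsInstance₂`.
  merge-parameters : (φ : Formula (suc n) 0) (a : Vec V n) →
    ∃[ p ] Σ (Formula 2 0) λ ψ → ∀ x → Sat M ψ (p ∷ x ∷ []) [] ⇔ Sat M φ (x ∷ a) []
  -- Without parameters, ∅ is a dummy that the renamed formula never mentions.
  merge-parameters φ [] = ∅ , rename (λ _ → v₁) φ , λ x →
    Sat-rename φ λ where zero → refl
  merge-parameters φ (y ∷ []) = y , rename ρ φ , λ x →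
    Sat-rename φ λ where zero → refl ; (suc zero) → refl
    where
    ρ : Fin 2 → Fin 2
    ρ zero    = v₁
    ρ (suc _) = v₀
  merge-parameters {suc (suc n)} φ (y ∷ z ∷ a) =
    let p , ψ , ψ⇔ = merge-parameters (formula merged) (⟪ y , z ⟫ ∷ a)
    in p , ψ , λ x → ψ⇔ x ⨾ defines merged (x ∷ ⟪ y , z ⟫ ∷ a) ⨾ unpack x
    where
    -- The target context is z, y, x, the pair, then the remaining parameters; index 3, the pair, is
    -- skipped.
    ρ : Fin (suc (suc (suc n))) → Fin (suc (suc (suc (suc n))))
    ρ zero                = v₂
    ρ (suc zero)          = v₁
    ρ (suc (suc zero))    = v₀
    ρ (suc (suc (suc i))) = 4 ↑ʳ i

    merged : Definable (λ v → ∃[ y ] ∃[ z ] IsPair M (lookup v v₁) y z ×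
                              Sat M (rename ρ φ) (z ∷ y ∷ v) [])
    merged = ∃ᵈ (∃ᵈ (IsPairᵈ v₃ v₁ v₀ ×ᵈ satᵈ (rename ρ φ)))

    sat⇔ : ∀ x y z p → Sat M (rename ρ φ) (z ∷ y ∷ x ∷ p ∷ a) [] ⇔ Sat M φ (x ∷ y ∷ z ∷ a) []
    sat⇔ x y z p = Sat-rename φ λ where
      zero                → refl
      (suc zero)          → refl
      (suc (suc zero))    → refl
      (suc (suc (suc i))) → refl

    unpack : ∀ x → (∃[ y′ ] ∃[ z′ ] IsPair M ⟪ y , z ⟫ y′ z′ ×
                     Sat M (rename ρ φ) (z′ ∷ y′ ∷ x ∷ ⟪ y , z ⟫ ∷ a) [])
                   ⇔ Sat M φ (x ∷ y ∷ z ∷ a) []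
    unpack x = mk⇔ (λ (y′ , z′ , h , sat) → go (⟪⟫-injective (IsPair⇒≡ h)) (to (sat⇔ x y′ z′ _) sat))
                   (λ sat → y , z , ⟪⟫-isPair , from (sat⇔ x y z _) sat)
      where
      go : ∀ {y′ z′} → y ≡ y′ × z ≡ z′ → Sat M φ (x ∷ y′ ∷ z′ ∷ a) [] → Sat M φ (x ∷ y ∷ z ∷ a) []
      go (refl , refl) sat = sat

  -- Variables are named by de Bruijn levels, so that a quantifier in a context
  -- of length n binds the fresh variable vₙ.
  level : Fin n → ℕ
  level {suc n} zero    = n
  level {suc n} (suc i) = level i

  level<n : (i : Fin n) → level i < n
  level<n {suc n} zero    = n<1+n n
  level<n {suc n} (suc i) = m<n⇒m<1+n (level<n i)

  varCode : ℕ → V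
  varCode m = ⟪ ∅ , num m ⟫

  varCode-isVar : ∀ m → IsVar M (varCode m) k ⇔ k ≡ num m
  varCode-isVar m = mk⇔ (λ h → sym (proj₂ (⟪⟫-injective (IsVar⇒≡ h))))
                        (λ where refl → num-isFiniteOrdinal m , tagged 0)

  mutual
    ⌜_⌝ : Formula n 0 → V
    ⌜ φ ⌝ = code (head φ)

    head : Formula n 0 → Head
    head (i ≈ᶠ j) = eq (varCode (level i)) (varCode (level j))
    head (i ∈ᶠ j) = mem (varCode (level i)) (varCode (level j))
    head (¬ᶠ φ)   = neg ⌜ φ ⌝
    head (φ ∨ᶠ ψ) = or ⌜ φ ⌝ ⌜ ψ ⌝
    head {n} (∃ᶠ φ) = ex (num n) ⌜ φ ⌝

  ⌜⌝-isHead : (φ : Formula n 0) → IsHead ⌜ φ ⌝ (head φ)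
  ⌜⌝-isHead (i ≈ᶠ j) = tagged-pair 0
  ⌜⌝-isHead (i ∈ᶠ j) = tagged-pair 1
  ⌜⌝-isHead (¬ᶠ φ)   = tagged 2
  ⌜⌝-isHead (φ ∨ᶠ ψ) = tagged-pair 3
  ⌜⌝-isHead {n} (∃ᶠ φ) = num-isFiniteOrdinal n , tagged-pair 4

  depth : Formula n 0 → ℕ
  depth (i ≈ᶠ j) = 0
  depth (i ∈ᶠ j) = 0
  depth (¬ᶠ φ)   = suc (depth φ)
  depth (φ ∨ᶠ ψ) = suc (depth φ ℕ.⊔ depth ψ)
  depth (∃ᶠ φ)   = suc (depth φ)

  ⊔-isMax : ∀ m n → IsMax M (num (m ℕ.⊔ n)) (num m) (num n)
  ⊔-isMax m n =
    ⊎-map (cong num) (cong num) (⊔-sel m n) , num-mono (m≤m⊔n m n) , num-mono (m≤n⊔m m n)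
    where
    num-mono : ∀ {m n} → m ≤ n → _≤ᵒ_ M (num m) (num n)
    num-mono = ⊎-map num-<⇒∈ (cong num) ∘ m≤n⇒m<n∨m≡n

  ⌜⌝-hasDepth : (φ : Formula n 0) → HasDepth M ⌜ φ ⌝ (num (depth φ))
  ⌜⌝-hasDepth φ = depth-fold (num-isFiniteOrdinal (depth φ)) (⌜⌝-isHead φ) (view φ)
    where
    isVar : (i : Fin n) → IsVar M (varCode (level i)) (num (level i))
    isVar i = from (varCode-isVar (level i)) refl

    view : (φ : Formula n 0) → DepthView (head φ) (num (depth φ))
    view (i ≈ᶠ j) = eq (isVar i) (isVar j) (num-isNumeral 0)
    view (i ∈ᶠ j) = mem (isVar i) (isVar j) (num-isNumeral 0)
    view (¬ᶠ φ)   = neg (⌜⌝-hasDepth φ) suc*-isSuc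
    view (φ ∨ᶠ ψ) = or (⌜⌝-hasDepth φ) (⌜⌝-hasDepth ψ) (⊔-isMax (depth φ) (depth ψ)) suc*-isSuc
    view (∃ᶠ φ)   = ex (⌜⌝-hasDepth φ) suc*-isSuc

  -- The body of a quantifier in a context of length `n` may also use vₙ, which is exactly the
  -- variable that is removed. For `n` = 2 the bound is the condition on free variables in `θ-Most`.
  ⌜⌝-freeVars : (φ : Formula n 0) →
    ∃[ f ] HasFreeVars M ⌜ φ ⌝ f × (∀ k → k ∈ f → ∃[ m ] m < n × k ≡ num m)
  ⌜⌝-freeVars {n} φ = case view φ of λ (f , v , bound) → f , freeVars-fold (⌜⌝-isHead φ) v , bound
    where
    variables : (i j : Fin n) → ∃[ f ]
      (∀ k → k ∈ f ⇔ (IsVar M (varCode (level i)) k ⊎ IsVar M (varCode (level j)) k)) ×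
      (∀ k → k ∈ f → ∃[ m ] m < n × k ≡ num m)
    variables i j = ⟅ num (level i) , num (level j) ⟆ ,
      (λ k → ∈-⟅⟆ ⨾ ⇔.sym (varCode-isVar (level i)) ⊎-⇔ ⇔.sym (varCode-isVar (level j))) ,
      (λ k h → [ (λ e → level i , level<n i , e) , (λ e → level j , level<n j , e) ]′ (to ∈-⟅⟆ h))

    view : (φ : Formula n 0) →
      ∃[ f ] FreeVarsView (head φ) f × (∀ k → k ∈ f → ∃[ m ] m < n × k ≡ num m)
    view (i ≈ᶠ j) = case variables i j of λ (f , h , bound) → f , eq h , bound
    view (i ∈ᶠ j) = case variables i j of λ (f , h , bound) → f , mem h , bound
    view (¬ᶠ φ)   = case ⌜⌝-freeVars φ of λ (f , h , bound) → f , neg h , bound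
    view (φ ∨ᶠ ψ) =
      case ⌜⌝-freeVars φ of λ (f , hf , bound) →
      case ⌜⌝-freeVars ψ of λ (g , hg , bound′) →
      f ∪ g , or hf hg (λ k → ∈-∪) , λ k h → [ bound k , bound′ k ]′ (to ∈-∪ h)
    view (∃ᶠ φ) =
      case ⌜⌝-freeVars φ of λ (g , hg , bound) →
      case separation (¬ᵈ v₀ ≡ᵈ v₁) (num n ∷ []) g of λ (f , hf) →
      f , ex hg hf , λ k h → let k∈g , k≢n = to (hf k) h in
           lower-bound k≢n (bound k k∈g)
      where
      lower-bound : k ≢ num n → ∃[ m ] m < suc n × k ≡ num m → ∃[ m ] m < n × k ≡ num m
      lower-bound k≢n (m , m<1+n , refl) with m<1+n⇒m<n∨m≡n m<1+n
      ... | inj₁ m<n  = m , m<n , refl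
      ... | inj₂ refl = contradiction refl k≢n

  ⌜⌝-Depth≤ : (φ : Formula n 0) → Depth≤ (depth φ) ⌜ φ ⌝
  ⌜⌝-Depth≤ φ = HasDepth⇒Depth≤ (depth φ) (⌜⌝-hasDepth φ) (inj₂ refl)

  varCode-subst : ∀ m → IsAssignment M s → ⟪ num m , a ⟫ ∈ s → IsTermSubst M s (varCode m) t →
                    IsConst M t a
  varCode-subst m (_ , fun) h (inj₁ (i , b , hv , h′ , ht))
    with refl ← to (varCode-isVar m) hv
    with refl ← fun _ _ _ (from ⟨⟩∈⇔ h) h′ = ht
  varCode-subst m _ h (inj₂ (inj₁ (i , hv , fresh , _)))
    with refl ← to (varCode-isVar m) hv = contradiction (from ⟨⟩∈⇔ h) (fresh _)
  varCode-subst m _ h (inj₂ (inj₂ (_ , hc , _))) =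
    contradiction hc (¬IsVar×IsConst (from (varCode-isVar m) refl))

  -- Induction on `φ` with `e` and `s` varying. At a quantifier `s` is updated at vₙ; the variables
  -- already in use have levels below `n` and keep their values.
  ⌜⌝-true : (φ : Formula n 0) {e : Vec V n} → Depth≤ m ⌜ φ ⌝ → IsAssignment M s →
            (∀ i → ⟪ num (level i) , lookup e i ⟫ ∈ s) → IsSubst M s ⌜ φ ⌝ χ →
            True m χ ⇔ Sat M φ e []
  ⌜⌝-true {n} {m} {s} φ {e} D as assigns hs =
    case subst-view-from (⌜⌝-isHead φ) hs of λ (_ , hχ , v) →
    true-at hχ ⨾ go φ assigns (depth≤-at (⌜⌝-isHead φ) D) v
    where
    go : ∀ {h′ m} (φ : Formula n 0) → (∀ i → ⟪ num (level i) , lookup e i ⟫ ∈ s) →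
         HeadDepth≤ m (head φ) → SubstView s (head φ) h′ → HeadTrue h′ m ⇔ Sat M φ e []
    go {m = m} (i ≈ᶠ j) assigns _ (eq ht hu) =
      eq-true m (varCode-subst (level i) as (assigns i) ht) (varCode-subst (level j) as (assigns j) hu)
    go {m = m} (i ∈ᶠ j) assigns _ (mem ht hu) =
      mem-true m (varCode-subst (level i) as (assigns i) ht) (varCode-subst (level j) as (assigns j) hu)
    go (¬ᶠ φ) assigns (neg D) (neg hs) = ¬-cong-⇔ (⌜⌝-true φ D as assigns hs)
    go (φ ∨ᶠ ψ) assigns (or D₁ D₂) (or hs₁ hs₂) =
      ⌜⌝-true φ D₁ as assigns hs₁ ⊎-⇔ ⌜⌝-true ψ D₂ as assigns hs₂
    go {m = suc m} (∃ᶠ φ) assigns (ex D) (ex {x = ψ} ws hs) = mk⇔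
      (λ (x , ψ′ , hi , tr) → x , to (instance-true x hi) tr)
      (λ (x , sat) → case instance-total (subst-Depth≤ D hs) (num n) x of λ (ψ′ , hi) →
        x , ψ′ , hi , from (instance-true x hi) sat)
      where
      instance-true : ∀ x {ψ′} → IsInstance M (num n) x ψ ψ′ → True m ψ′ ⇔ Sat M φ (x ∷ e) []
      instance-true x hi =
        case update s (num n) x of λ (u , up) →
        ⌜⌝-true φ D (update-isAssignment (num-isFiniteOrdinal n) as up)
          (λ where
            zero    → from (∈-update up) (inj₂ (refl , refl))
            (suc i) → from (∈-update up)
              (inj₁ (assigns i , λ eq → <⇒≢ (level<n i) (num-injective eq))))
          (instance-compose D ws up hs hi)

  instance₂-total : Depth≤ n φ → ∀ b a → ∃ (IsInstance₂ M b a φ)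
  instance₂-total D b a =
    case subst-total D ⟅ ⟪ num 0 , b ⟫ , ⟪ num 1 , a ⟫ ⟆ of λ (χ , hs) →
    χ , ⟅ ⟪ num 0 , b ⟫ , ⟪ num 1 , a ⟫ ⟆ , num 0 , num 1 , ⟪ num 0 , b ⟫ , ⟪ num 1 , a ⟫ , num-isNumeral 0 , num-isNumeral 1 , ⟪⟫-isPair {num 0} {b} ,
    ⟪⟫-isPair {num 1} {a} , (λ z → ∈-⟅⟆) , hs

  instance₂⇒subst : IsInstance₂ M b a φ χ →
                    IsSubst M ⟅ ⟪ num 0 , b ⟫ , ⟪ num 1 , a ⟫ ⟆ φ χ
  instance₂⇒subst (_ , _ , _ , _ , _ , h₀ , h₁ , hp , hq , hs , h) =
    subst (λ s → IsSubst M s _ _)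
      (trans (IsUPair⇒≡ hs) (cong₂ ⟅_,_⟆
        (trans (IsPair⇒≡ hp) (cong ⟪_, _ ⟫ (IsNumeral⇒≡ 0 h₀)))
        (trans (IsPair⇒≡ hq) (cong ⟪_, _ ⟫ (IsNumeral⇒≡ 1 h₁))))) h

  pair-isAssignment : ∀ b a → IsAssignment M ⟅ ⟪ num 0 , b ⟫ , ⟪ num 1 , a ⟫ ⟆
  pair-isAssignment b a = dom , fun
    where
    dom : ∀ p → p ∈ ⟅ ⟪ num 0 , b ⟫ , ⟪ num 1 , a ⟫ ⟆ →
          ∃[ i ] ∃[ c ] IsFiniteOrdinal M i × IsPair M p i c
    dom p h with to ∈-⟅⟆ h
    ... | inj₁ refl = num 0 , b , num-isFiniteOrdinal 0 , ⟪⟫-isPair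
    ... | inj₂ refl = num 1 , a , num-isFiniteOrdinal 1 , ⟪⟫-isPair

    entries : ∀ {i c} → ⟨_,_⟩∈_ M i c ⟅ ⟪ num 0 , b ⟫ , ⟪ num 1 , a ⟫ ⟆ →
              (i ≡ num 0 × c ≡ b) ⊎ (i ≡ num 1 × c ≡ a)
    entries = ⊎-map ⟪⟫-injective ⟪⟫-injective ∘ to ∈-⟅⟆ ∘ to ⟨⟩∈⇔

    fun : ∀ i c c′ → ⟨_,_⟩∈_ M i c ⟅ ⟪ num 0 , b ⟫ , ⟪ num 1 , a ⟫ ⟆ →
          ⟨_,_⟩∈_ M i c′ ⟅ ⟪ num 0 , b ⟫ , ⟪ num 1 , a ⟫ ⟆ → c ≡ c′
    fun i c c′ h h′ with entries h | entries h′
    ... | inj₁ (_ , e) | inj₁ (_ , e′) = trans e (sym e′)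
    ... | inj₂ (_ , e) | inj₂ (_ , e′) = trans e (sym e′)
    ... | inj₁ (e , _) | inj₂ (e′ , _) with () ← num-injective {0} {1} (trans (sym e) e′)
    ... | inj₂ (e , _) | inj₁ (e′ , _) with () ← num-injective {1} {0} (trans (sym e) e′)

  instance₂-sentence : HasDepth M φ d → HasFreeVars M φ f →
    (∀ i → i ∈ f → IsNumeral M 0 i ⊎ IsNumeral M 1 i) → IsInstance₂ M b a φ χ →
    IsSentenceOfDepth M χ d
  instance₂-sentence {φ = φ} {f = f} {b = b} {a = a} hd hf vars hi =
    φ , f , _ , hd , hf , pair-isAssignment b a , cover , instance₂⇒subst hi
    where
    cover : ∀ i → i ∈ f → ∃[ c ] ⟨_,_⟩∈_ M i c ⟅ ⟪ num 0 , b ⟫ , ⟪ num 1 , a ⟫ ⟆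
    cover i i∈f with vars i i∈f
    ... | inj₁ h with refl ← IsNumeral⇒≡ 0 h = b , from ⟨⟩∈⇔ x∈⟅x,y⟆
    ... | inj₂ h with refl ← IsNumeral⇒≡ 1 h = a , from ⟨⟩∈⇔ y∈⟅x,y⟆

  -- Both halves of the theorem rest on this: for an instance of a formula of
  -- standard depth, every truth class witnessing T-Most agrees with True n.
  T-Most⇔True : ∀ {ℓ″} (𝔜 : Classes M ℓ″) → Classes.IsClass 𝔜 (TruthClass n) →
    IsNumeral M n d → IsSentenceOfDepth M χ d → T-Most M 𝔜 χ ⇔ True n χ
  T-Most⇔True {n} {d} {χ} 𝔜 cls hn S = mk⇔
    (λ (_ , _ , _ , ωp , _ , T , _ , Tχ , truth) →
      -- The standard bound comes from `S`, and membership among the sentences of depth at most `p`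
      -- from the truth class itself.
      to (truthClass⇔True ωp truth (depthSentence⇒Depth≤ n S″)
           (IsDepthTruthClass.sentences truth _ Tχ)) Tχ)
    (λ tr → num n , S′ , num n , num-isFiniteOrdinal n , inj₂ refl , TruthClass n , cls ,
      (S″ , tr) , truthClass-isDepthTruthClass n)
    where
    S′ : IsSentenceOfDepth M χ (num n)
    S′ = subst (IsSentenceOfDepth M χ) (IsNumeral⇒≡ n hn) S

    S″ : IsDepthSentence M (num n) χ
    S″ = num n , inj₂ refl , S′

  instance₂-true : (ψ : Formula 2 0) → IsInstance₂ M b a ⌜ ψ ⌝ χ →
                   True (depth ψ) χ ⇔ Sat M ψ (a ∷ b ∷ []) []
  instance₂-true {b} {a} ψ hi =
    ⌜⌝-true ψ (⌜⌝-Depth≤ ψ) (pair-isAssignment b a)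
      (λ where zero → y∈⟅x,y⟆ ; (suc zero) → x∈⟅x,y⟆) (instance₂⇒subst hi)

  instance₂-true-definable : ∀ n φ a →
    IsDefinable M (λ b → ∃[ χ ] IsInstance₂ M b a φ χ × True n χ)
  instance₂-true-definable n φ a =
    definable⇒IsDefinable (∃ᵈ (IsInstance₂ᵈ v₁ v₂ v₃ v₀ ×ᵈ Trueᵈ n v₀)) (a ∷ φ ∷ [])

  -- The two halves of the theorem.

  θ-Most⇒definable : OmegaStandard M → θ-Most M 𝔛 → ∀ {X} → Classes.IsClass 𝔛 X → IsDefinable M X
  θ-Most⇒definable ωst θ {X} hX =
    case θ X hX of λ (φ , d , f , a , hd , hf , vars , X⇔) →
    case ωst d (proj₁ hd) of λ (n , hn) →
    let T⇔ : ∀ b χ → IsInstance₂ M b a φ χ → T-Most M 𝔛 χ ⇔ True n χ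
        T⇔ b χ hi = T-Most⇔True 𝔛 (definable⇒class (TruthClassᵈ n) []) hn
                      (instance₂-sentence hd hf vars hi)
    in Classes.respects (𝔛-Def M)
      ( (λ {b} (χ , hi , t) → from (X⇔ b) (χ , hi , from (T⇔ b χ hi) t))
      , (λ {b} h → case to (X⇔ b) h of λ (χ , hi , t) → χ , hi , to (T⇔ b χ hi) t))
      (instance₂-true-definable n φ a)

  -- The converse inclusion in (a) is comprehension without class parameters.
  definable⇒isClass : ∀ {X} → IsDefinable M X → Classes.IsClass 𝔛 X
  definable⇒isClass (n , φ , a , X⊆φ , φ⊆X) =
    Classes.respects 𝔛 (φ⊆X , X⊆φ) (GBCore.comprehension gb φ a [] [])

  θ-Most-𝔛-Def : θ-Most M (𝔛-Def M)
  θ-Most-𝔛-Def X (n , φ , a , X⊆φ , φ⊆X) =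
    case merge-parameters φ a of λ (p , ψ , ψ⇔) →
    case ⌜⌝-freeVars ψ of λ (f , hf , bound) →
    let vars : ∀ i → i ∈ f → IsNumeral M 0 i ⊎ IsNumeral M 1 i
        vars i i∈f = numeral<2 (bound i i∈f)

        T⇔ : ∀ b χ → IsInstance₂ M b p ⌜ ψ ⌝ χ → T-Most M (𝔛-Def M) χ ⇔ Sat M φ (b ∷ a) []
        T⇔ b χ hi =
          T-Most⇔True (𝔛-Def M) (definable⇒IsDefinable (TruthClassᵈ (depth ψ)) [])
            (num-isNumeral (depth ψ)) (instance₂-sentence (⌜⌝-hasDepth ψ) hf vars hi)
          ⨾ instance₂-true ψ hi ⨾ ψ⇔ b
    in ⌜ ψ ⌝ , num (depth ψ) , f , p , ⌜⌝-hasDepth ψ , hf , vars , λ b → mk⇔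
      (λ h → case instance₂-total (⌜⌝-Depth≤ ψ) b p of λ (χ , hi) →
        χ , hi , from (T⇔ b χ hi) (X⊆φ h))
      (λ (χ , hi , t) → φ⊆X (to (T⇔ b χ hi) t))
    where
    numeral<2 : ∀ {k} → ∃[ m ] m < 2 × k ≡ num m → IsNumeral M 0 k ⊎ IsNumeral M 1 k
    numeral<2 (0 , _ , refl) = inj₁ (num-isNumeral 0)
    numeral<2 (1 , _ , refl) = inj₂ (num-isNumeral 1)
    numeral<2 (suc (suc _) , s≤s (s≤s ()) , _)

theorem3p11 : ∀ {ℓ ℓ′ : Level} → ExcludedMiddle (lsuc ℓ ⊔ ℓ′) →
    (M : SetStructure ℓ) (𝔛 : Classes M ℓ′) →
    GB⁺ M 𝔛 ⊎ GB⁻ M 𝔛 →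
    (OmegaStandard M → θ-Most M 𝔛 →
    Classes.IsClass 𝔛 ≐ Classes.IsClass (𝔛-Def M)) ×
    θ-Most M (𝔛-Def M)
theorem3p11 {ℓ} {ℓ′} em M 𝔛 gb =
  (λ ωst θ → θ-Most⇒definable ωst θ , definable⇒isClass) , θ-Most-𝔛-Def
  where
  -- Satisfaction lives at level ℓ; excluded middle there follows from the given instance by
  -- lifting.
  open Coding (λ {P} → map′ lower lift (em {P = Lift (lsuc ℓ ⊔ ℓ′) P})) M 𝔛 ([ proj₁ , proj₁ ]′ gb)
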